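{- Let $n\ge1$ and let $W_0(t)=\sum_{w\in S_n}t^{\ell(w)}$ be the Poincaré polynomial of $S_n$. Then $$t^{ -\frac12\ell(w_0)}W_0(t)=\mathrm{ev}^t_0(c^Y_{w_0})=\sum_{w\in S_n}w\,c^{X^{ -1}}_{w_0}$$ and $$W_0(t)=\prod_{1\le i<j\le n}\frac{1-t^{j-i+1}}{1-t^{j-i}}=[n]!,\qquad\text{where}\quad[n]!=\prod_{d=1}^n\frac{1-t^d}{1-t}.$$
   Context: $t^{1/2}$ is an indeterminate over $\mathbb{C}$, $t=(t^{1/2})^2$; $\ell$ is the length function of $S_n$ and $w_0$ its longest element. In commuting variables $x_1,\ldots,x_n$ (on which $S_n$ acts by permutation) and $Y_1,\ldots,Y_n$, $$c^{X^{ -1}}_{w_0}=\prod_{1\le i<j\le n}\frac{t^{ -\frac12}-t^{\frac12}x_i^{ -1}x_j}{1-x_i^{ -1}x_j},\qquad c^Y_{w_0}=\prod_{1\le i<j\le n}\frac{t^{ -\frac12}-t^{\frac12}Y_iY_j^{ -1}}{1-Y_iY_j^{ -1}},$$ and $\mathrm{ev}^t_0$ is the evaluation $Y_i\mapsto t^{ -(i-1)+\frac12(n-1)}$. -}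

module Defs where

open import Level using (Level; _⊔_; 0ℓ)
open import Algebra.Bundles using (CommutativeRing; RawRing)
open import Algebra.Apartness.Bundles using (HeytingField; HeytingCommutativeRing)
open import Algebra.Morphism.Structures using (IsRingHomomorphism)
import Algebra.Definitions.RawSemiring as RawSemiringDefs
import Algebra.Morphism.Construct.Identity as Identity
import Algebra.Properties.AbelianGroup as AbelianGroupProperties
import Algebra.Properties.Ring as RingProperties
import Algebra.Properties.Semiring.Exp as Exp
open import Data.Bool.Base using (if_then_else_)
open import Data.Fin.Base using (Fin; zero; suc; toℕ; punchIn) renaming (_<_ to _<ᶠ_)
open import Data.Fin.Permutation as Perm
  using (Permutation′; _⟨$⟩ʳ_; _⟨$⟩ˡ_; insert; remove)
open import Data.Fin.Properties as Finₚ using (_≟_; _<?_; punchIn-injective)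
open import Data.Integer.Base as ℤ using (ℤ; +_; -[1+_])
open import Data.List.Base using (List; []; _∷_; foldr; map; allFin; cartesianProductWith)
open import Data.List.Membership.Propositional.Properties using (∈-allFin)
import Data.List.Membership.Setoid as SetoidMembership
import Data.List.Membership.Setoid.Properties as SetoidMembershipₚ
import Data.List.Relation.Unary.Unique.Setoid as SetoidUnique
import Data.List.Relation.Unary.Unique.Setoid.Properties as SetoidUniqueₚ
import Data.List.Relation.Unary.Unique.Propositional.Properties as Uniqueₚ
open import Data.List.Relation.Unary.Any using (here)
open import Data.List.Relation.Unary.All using ([])
open import Data.List.Relation.Unary.AllPairs using ([]; _∷_)
open import Data.Nat.Base as ℕ using (ℕ; zero; suc)
import Data.Nat.Properties as ℕₚ
open import Data.Product.Base using (_×_; _,_; ∃; proj₁; proj₂)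
open import Relation.Binary.Bundles using (Setoid)
import Relation.Binary.Reasoning.Setoid as SetoidReasoning
open import Relation.Binary.PropositionalEquality as ≡ using (_≡_; _≢_)
open import Relation.Nullary using (Dec; yes; no; does; contradiction)
open import Relation.Nullary.Decidable using (_×-dec_)

private variable
  c ℓ : Level
  n : ℕ

------------------------------------------------------------------------
-- The symmetric group

permutationSetoid : ℕ → Setoid 0ℓ 0ℓ
permutationSetoid n = record
  { Carrier       = Permutation′ n
  ; _≈_           = Perm._≈_
  ; isEquivalence = record
    { refl  = λ _ → ≡.refl
    ; sym   = λ p i → ≡.sym (p i)
    ; trans = λ p q i → ≡.trans (p i) (q i)
    }
  }

-- Every permutation of Fin n, listed exactly once: a permutation w of
-- Fin (suc n) is given by w(0) and an arbitrary permutation of the rest.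
S : ∀ n → List (Permutation′ n)
S zero    = Perm.id ∷ []
S (suc n) = cartesianProductWith (insert zero) (allFin (suc n)) (S n)

private
  insert-cong : ∀ {i j} {π ρ : Permutation′ n} → i ≡ j → π Perm.≈ ρ →
                insert zero i π Perm.≈ insert zero j ρ
  insert-cong         i≡j    π≈ρ zero    = i≡j
  insert-cong {j = j} ≡.refl π≈ρ (suc k) = ≡.cong (punchIn j) (π≈ρ k)

  insert-injective : ∀ {i j} {π ρ : Permutation′ n} →
                     insert zero i π Perm.≈ insert zero j ρ → i ≡ j × π Perm.≈ ρ
  insert-injective eq with eq zero
  ... | ≡.refl = ≡.refl , λ k → punchIn-injective _ _ _ (eq (suc k))

S-complete : ∀ n (π : Permutation′ n) →
             SetoidMembership._∈_ (permutationSetoid n) π (S n)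
S-complete zero    π = here λ ()
S-complete (suc n) π = SetoidMembershipₚ.∈-resp-≈ (permutationSetoid (suc n))
  {x = insert zero (π ⟨$⟩ʳ zero) (remove zero π)} {y = π} (Perm.insert-remove zero π)
  (SetoidMembershipₚ.∈-cartesianProductWith⁺
    (≡.setoid (Fin (suc n))) (permutationSetoid n) (permutationSetoid (suc n))
    insert-cong (∈-allFin (π ⟨$⟩ʳ zero)) (S-complete n (remove zero π)))

S-unique : ∀ n → SetoidUnique.Unique (permutationSetoid n) (S n)
S-unique zero    = [] ∷ []
S-unique (suc n) = SetoidUniqueₚ.cartesianProductWith⁺
  (≡.setoid (Fin (suc n))) (permutationSetoid n) (permutationSetoid (suc n))
  (insert zero) insert-injective (Uniqueₚ.allFin⁺ (suc n)) (S-unique n)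

-- The number of inversions, i.e. of pairs i < j with w(j) < w(i).
length : Permutation′ n → ℕ
length w = sum λ i → sum λ j →
  if does ((i <? j) ×-dec ((w ⟨$⟩ʳ j) <? (w ⟨$⟩ʳ i))) then 1 else 0
  where open RawSemiringDefs ℕ.+-*-rawSemiring using (sum)

IsLongest : Permutation′ n → Set
IsLongest {n} w₀ = ∀ (w : Permutation′ n) → length w ℕ.≤ length w₀

------------------------------------------------------------------------
-- Finite sums and products, non-zero-divisors

module RingNotation (R : CommutativeRing c ℓ) where
  open CommutativeRing R
  open RawSemiringDefs (RawRing.rawSemiring rawRing) public using (_^_; product)

  sumS : ∀ n → (Permutation′ n → Carrier) → Carrier
  sumS n f = foldr _+_ 0# (map f (S n))

  factorIf : ∀ {P : Set} → (P → Carrier) → Dec P → Carrier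
  factorIf f (yes p) = f p
  factorIf f (no _)  = 1#

  -- ∏ over 0 ≤ i < j < n; the factor may use the proof of i < j.
  ∏< : ∀ n → (∀ (i j : Fin n) → i <ᶠ j → Carrier) → Carrier
  ∏< n f = product λ i → product λ j → factorIf (f i j) (i <? j)

  record Regular (a : Carrier) : Set (c ⊔ ℓ) where
    constructor regular
    no-eta-equality
    field annihilated : ∀ b → a * b ≈ 0# → b ≈ 0#
  open Regular public

  open SetoidReasoning setoid
  open AbelianGroupProperties +-abelianGroup using (x∙y⁻¹≈ε⇒x≈y; x≈y⇒x∙y⁻¹≈ε)
  open RingProperties ring using (-‿distribʳ-*)

  regular-cong : ∀ {a b} → a ≈ b → Regular a → Regular b
  regular-cong a≈b reg = regular λ x bx≈0 → annihilated reg x (trans (*-congʳ a≈b) bx≈0)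

  regular-1 : Regular 1#
  regular-1 = regular λ b eq → trans (sym (*-identityˡ b)) eq

  regular-* : ∀ {a b} → Regular a → Regular b → Regular (a * b)
  regular-* ra rb = regular λ x eq → annihilated rb x (annihilated ra _ (trans (sym (*-assoc _ _ x)) eq))

  regular-cancel : ∀ {a} → Regular a → ∀ x y → a * x ≈ a * y → x ≈ y
  regular-cancel {a} ra x y eq = x∙y⁻¹≈ε⇒x≈y x y (annihilated ra (x - y) (begin
    a * (x - y)        ≈⟨ distribˡ a x (- y) ⟩
    a * x + a * - y    ≈⟨ +-congˡ (-‿distribʳ-* a y) ⟨
    a * x - a * y      ≈⟨ x≈y⇒x∙y⁻¹≈ε eq ⟩
    0#                 ∎))

module Identities (R : CommutativeRing c ℓ) where
  open CommutativeRing R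
  open import Algebra.Solver.Ring.NaturalCoefficients.Default commutativeSemiring
    using (solve; _:=_; _:+_; _:*_)

  ∂-+ : ∀ s t h x y →
    (s + h * x) + (t + h * y) ≈ (s + t) + h * (x + y)
  ∂-+ = solve 5 (λ s t h x y →
    ((s :+ h :* x) :+ (t :+ h :* y)) :=
    ((s :+ t) :+ h :* (x :+ y))) refl

  ∂-* : ∀ s t h x y q →
    s * (t + h * y) + h * x * q ≈ s * t + h * (x * q + s * y)
  ∂-* = solve 6 (λ s t h x y q →
    (s :* (t :+ h :* y) :+ h :* x :* q) :=
    (s :* t :+ h :* (x :* q :+ s :* y))) refl

  ∂-assoc : ∀ p′ q r s q′ t r′ →
    (p′ * q + s * q′) * r + (s * t) * r′ ≈ p′ * (q * r) + s * (q′ * r + t * r′)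
  ∂-assoc = solve 7 (λ p′ q r s q′ t r′ →
    ((p′ :* q :+ s :* q′) :* r :+ (s :* t) :* r′) :=
    (p′ :* (q :* r) :+ s :* (q′ :* r :+ t :* r′))) refl

  ∂-comm : ∀ p′ t h q′ s →
    p′ * (t + h * q′) + s * q′ ≈ q′ * (s + h * p′) + t * p′
  ∂-comm = solve 5 (λ p′ t h q′ s →
    (p′ :* (t :+ h :* q′) :+ s :* q′) :=
    (q′ :* (s :+ h :* p′) :+ t :* p′)) refl

  ∂-distrib : ∀ p′ q r s q′ r′ →
    p′ * (q + r) + s * (q′ + r′) ≈ (p′ * q + s * q′) + (p′ * r + s * r′)
  ∂-distrib = solve 6 (λ p′ q r s q′ r′ →
    (p′ :* (q :+ r) :+ s :* (q′ :+ r′)) :=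
    ((p′ :* q :+ s :* q′) :+ (p′ :* r :+ s :* r′))) refl

  trans₁ : ∀ a b c →
    a * (b * c) ≈ (b * a) * c
  trans₁ = solve 3 (λ a b c →
    (a :* (b :* c)) :=
    ((b :* a) :* c)) refl

  trans₂ : ∀ a b c →
    (a * b) * c ≈ (a * c) * b
  trans₂ = solve 3 (λ a b c →
    ((a :* b) :* c) :=
    ((a :* c) :* b)) refl

  trans₃ : ∀ a b c →
    (a * b) * c ≈ b * (a * c)
  trans₃ = solve 3 (λ a b c →
    ((a :* b) :* c) :=
    (b :* (a :* c))) refl

  cong₁ : ∀ a b c d e f →
    (a * b + c * d) * (e * f) ≈ (a * e) * (b * f) + (c * f) * (d * e)
  cong₁ = solve 6 (λ a b c d e f →
    ((a :* b :+ c :* d) :* (e :* f)) :=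
    ((a :* e) :* (b :* f) :+ (c :* f) :* (d :* e))) refl

  cong₂ : ∀ a b c d e f →
    (a * b) * (c * d) + (e * c) * (b * f) ≈ (a * d + e * f) * (b * c)
  cong₂ = solve 6 (λ a b c d e f →
    ((a :* b) :* (c :* d) :+ (e :* c) :* (b :* f)) :=
    ((a :* d :+ e :* f) :* (b :* c))) refl

  interchange : ∀ a b c d →
    (a * b) * (c * d) ≈ (a * c) * (b * d)
  interchange = solve 4 (λ a b c d →
    ((a :* b) :* (c :* d)) :=
    ((a :* c) :* (b :* d))) refl

  +-assoc-frac : ∀ a a′ b b′ c c′ →
    ((a * b′ + b * a′) * c′ + c * (a′ * b′)) * (a′ * (b′ * c′)) ≈ (a * (b′ * c′) + (b * c′ + c * b′) * a′) * ((a′ * b′) * c′)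
  +-assoc-frac = solve 6 (λ a a′ b b′ c c′ →
    (((a :* b′ :+ b :* a′) :* c′ :+ c :* (a′ :* b′)) :* (a′ :* (b′ :* c′))) :=
    ((a :* (b′ :* c′) :+ (b :* c′ :+ c :* b′) :* a′) :* ((a′ :* b′) :* c′))) refl

  +-comm-frac : ∀ a a′ b b′ →
    (a * b′ + b * a′) * (b′ * a′) ≈ (b * a′ + a * b′) * (a′ * b′)
  +-comm-frac = solve 4 (λ a a′ b b′ →
    ((a :* b′ :+ b :* a′) :* (b′ :* a′)) :=
    ((b :* a′ :+ a :* b′) :* (a′ :* b′))) refl

  distrib-frac : ∀ a a′ b b′ c c′ →
    (a * (b * c′ + c * b′)) * ((a′ * b′) * (a′ * c′)) ≈ ((a * b) * (a′ * c′) + (a * c) * (a′ * b′)) * (a′ * (b′ * c′))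
  distrib-frac = solve 6 (λ a a′ b b′ c c′ →
    ((a :* (b :* c′ :+ c :* b′)) :* ((a′ :* b′) :* (a′ :* c′))) :=
    (((a :* b) :* (a′ :* c′) :+ (a :* c) :* (a′ :* b′)) :* (a′ :* (b′ :* c′)))) refl

  value₁ : ∀ a b c →
    (a * b) * c ≈ (c * a) * b
  value₁ = solve 3 (λ a b c →
    ((a :* b) :* c) :=
    ((c :* a) :* b)) refl

  value₂ : ∀ a b c →
    (a * b) * c ≈ (c * b) * a
  value₂ = solve 3 (λ a b c →
    ((a :* b) :* c) :=
    ((c :* b) :* a)) refl

------------------------------------------------------------------------
-- The polynomial ring R[X₀,…,Xₘ₋₁], as the free commutative R-algebra:
-- _≋_ is the least congruence making Poly a commutative ring and con a ring
-- homomorphism.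

module Polynomial (R : CommutativeRing c ℓ) (m : ℕ) where
  private module R = CommutativeRing R

  infixl 6 _⊕_
  infixl 7 _⊗_
  infix  8 ⊝_
  infix  4 _≋_

  data Poly : Set c where
    con     : R.Carrier → Poly
    var     : Fin m → Poly
    _⊕_ _⊗_ : Poly → Poly → Poly
    ⊝_      : Poly → Poly

  data _≋_ : Poly → Poly → Set (c ⊔ ℓ) where
    ≋-refl    : ∀ {p} → p ≋ p
    ≋-sym     : ∀ {p q} → p ≋ q → q ≋ p
    ≋-trans   : ∀ {p q r} → p ≋ q → q ≋ r → p ≋ r
    con-cong  : ∀ {a b} → a R.≈ b → con a ≋ con b
    con-+     : ∀ a b → con (a R.+ b) ≋ con a ⊕ con b
    con-*     : ∀ a b → con (a R.* b) ≋ con a ⊗ con b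
    ⊕-cong    : ∀ {p p′ q q′} → p ≋ p′ → q ≋ q′ → p ⊕ q ≋ p′ ⊕ q′
    ⊗-cong    : ∀ {p p′ q q′} → p ≋ p′ → q ≋ q′ → p ⊗ q ≋ p′ ⊗ q′
    ⊝-cong    : ∀ {p p′} → p ≋ p′ → ⊝ p ≋ ⊝ p′
    ⊕-assoc   : ∀ p q r → (p ⊕ q) ⊕ r ≋ p ⊕ (q ⊕ r)
    ⊕-comm    : ∀ p q → p ⊕ q ≋ q ⊕ p
    ⊕-idˡ     : ∀ p → con R.0# ⊕ p ≋ p
    ⊝-invˡ    : ∀ p → ⊝ p ⊕ p ≋ con R.0#
    ⊗-assoc   : ∀ p q r → (p ⊗ q) ⊗ r ≋ p ⊗ (q ⊗ r)
    ⊗-comm    : ∀ p q → p ⊗ q ≋ q ⊗ p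
    ⊗-idˡ     : ∀ p → con R.1# ⊗ p ≋ p
    ⊗-distribˡ : ∀ p q r → p ⊗ (q ⊕ r) ≋ (p ⊗ q) ⊕ (p ⊗ r)

  ring : CommutativeRing c (c ⊔ ℓ)
  ring = record
    { Carrier = Poly
    ; _≈_ = _≋_
    ; _+_ = _⊕_
    ; _*_ = _⊗_
    ; -_  = ⊝_
    ; 0#  = con R.0#
    ; 1#  = con R.1#
    ; isCommutativeRing = record
      { isRing = record
        { +-isAbelianGroup = record
          { isGroup = record
            { isMonoid = record
              { isSemigroup = record
                { isMagma = record
                  { isEquivalence = record { refl = ≋-refl ; sym = ≋-sym ; trans = ≋-trans }
                  ; ∙-cong = ⊕-cong
                  }
                ; assoc = ⊕-assoc
                }
              ; identity = ⊕-idˡ , λ p → ≋-trans (⊕-comm _ _) (⊕-idˡ p)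
              }
            ; inverse = ⊝-invˡ , λ p → ≋-trans (⊕-comm _ _) (⊝-invˡ p)
            ; ⁻¹-cong = ⊝-cong
            }
          ; comm = ⊕-comm
          }
        ; *-cong = ⊗-cong
        ; *-assoc = ⊗-assoc
        ; *-identity = ⊗-idˡ , λ p → ≋-trans (⊗-comm _ _) (⊗-idˡ p)
        ; distrib = ⊗-distribˡ , λ p q r → ≋-trans (⊗-comm _ _)
            (≋-trans (⊗-distribˡ p q r) (⊕-cong (⊗-comm _ _) (⊗-comm _ _)))
        }
      ; *-comm = ⊗-comm
      }
    }

  module P = CommutativeRing ring

  con-isRingHomomorphism : IsRingHomomorphism R.rawRing P.rawRing con
  con-isRingHomomorphism = record
    { isSemiringHomomorphism = record
      { isNearSemiringHomomorphism = record
        { +-isMonoidHomomorphism = record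
          { isMagmaHomomorphism = record
            { isRelHomomorphism = record { cong = con-cong }
            ; homo = con-+
            }
          ; ε-homo = ≋-refl
          }
        ; *-homo = con-*
        }
      ; 1#-homo = ≋-refl
      }
    ; -‿homo = λ a → inverseˡ-unique (con (R.- a)) (con a)
        (≋-trans (≋-sym (con-+ _ _)) (con-cong (R.-‿inverseˡ a)))
    }
    where open AbelianGroupProperties P.+-abelianGroup using (inverseˡ-unique)

  module Evaluation {a ℓ′} (A : CommutativeRing a ℓ′)
    {φ : R.Carrier → CommutativeRing.Carrier A}
    (φ-hom : IsRingHomomorphism R.rawRing (CommutativeRing.rawRing A) φ)
    (y : Fin m → CommutativeRing.Carrier A) where
    private module A = CommutativeRing A
    private module φ = IsRingHomomorphism φ-hom

    eval : Poly → A.Carrier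
    eval (con a) = φ a
    eval (var i) = y i
    eval (p ⊕ q) = eval p A.+ eval q
    eval (p ⊗ q) = eval p A.* eval q
    eval (⊝ p)   = A.- eval p

    eval-cong : ∀ {p q} → p ≋ q → eval p A.≈ eval q
    eval-cong ≋-refl             = A.refl
    eval-cong (≋-sym e)          = A.sym (eval-cong e)
    eval-cong (≋-trans e f)      = A.trans (eval-cong e) (eval-cong f)
    eval-cong (con-cong e)       = φ.⟦⟧-cong e
    eval-cong (con-+ a b)        = φ.+-homo a b
    eval-cong (con-* a b)        = φ.*-homo a b
    eval-cong (⊕-cong e f)       = A.+-cong (eval-cong e) (eval-cong f)
    eval-cong (⊗-cong e f)       = A.*-cong (eval-cong e) (eval-cong f)
    eval-cong (⊝-cong e)         = A.-‿cong (eval-cong e)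
    eval-cong (⊕-assoc p q r)    = A.+-assoc _ _ _
    eval-cong (⊕-comm p q)       = A.+-comm _ _
    eval-cong (⊕-idˡ p)          = A.trans (A.+-congʳ φ.0#-homo) (A.+-identityˡ _)
    eval-cong (⊝-invˡ p)         = A.trans (A.-‿inverseˡ _) (A.sym φ.0#-homo)
    eval-cong (⊗-assoc p q r)    = A.*-assoc _ _ _
    eval-cong (⊗-comm p q)       = A.*-comm _ _
    eval-cong (⊗-idˡ p)          = A.trans (A.*-congʳ φ.1#-homo) (A.*-identityˡ _)
    eval-cong (⊗-distribˡ p q r) = A.distribˡ _ _ _

  open Evaluation R (Identity.isRingHomomorphism R.rawRing R.refl) public
    using () renaming (eval to evalAt; eval-cong to evalAt-cong)

  open Evaluation ring con-isRingHomomorphism public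
    using () renaming (eval to subst; eval-cong to subst-cong)

  rename : (Fin m → Fin m) → Poly → Poly
  rename f = subst (λ i → var (f i))

  private
    module I = Identities ring
    open RingNotation ring using (Regular; regular; annihilated; regular-cong)
    open SetoidReasoning P.setoid
    open RingProperties P.ring using (-‿distribˡ-*; -‿distribʳ-*)
    open AbelianGroupProperties P.+-abelianGroup
      using (⁻¹-anti-homo-∙; ⁻¹-∙-comm; ε⁻¹≈ε; x∙y⁻¹≈ε⇒x≈y; x≈y⇒x∙y⁻¹≈ε; inverseˡ-unique)

  rename-inverse : ∀ f g → (∀ i → g (f i) ≡ i) → ∀ p → rename g (rename f p) ≋ p
  rename-inverse f g gf (con a) = ≋-refl
  rename-inverse f g gf (var i) = P.reflexive (≡.cong var (gf i))
  rename-inverse f g gf (p ⊕ q) = ⊕-cong (rename-inverse f g gf p) (rename-inverse f g gf q)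
  rename-inverse f g gf (p ⊗ q) = ⊗-cong (rename-inverse f g gf p) (rename-inverse f g gf q)
  rename-inverse f g gf (⊝ p)   = ⊝-cong (rename-inverse f g gf p)

  rename-regular : ∀ f g → (∀ i → g (f i) ≡ i) → (∀ i → f (g i) ≡ i) →
                   ∀ {p} → Regular p → Regular (rename f p)
  rename-regular f g gf fg {p} reg = regular λ r eq → begin
    r                      ≈⟨ rename-inverse g f fg r ⟨
    rename f (rename g r)  ≈⟨ subst-cong _ (annihilated reg (rename g r) (eq′ r eq)) ⟩
    con R.0#               ∎
    where
    eq′ : ∀ r → rename f p ⊗ r ≋ con R.0# → p ⊗ rename g r ≋ con R.0#
    eq′ r eq = ≋-trans (⊗-cong (≋-sym (rename-inverse f g gf p)) ≋-refl) (subst-cong _ eq)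

  -- The divided difference ∂ p = (p − σ p) / (Xᵥ − a), where σ substitutes
  -- Xᵥ ↦ a. It shows that Xᵥ − a is not a zero divisor if a does not
  -- involve Xᵥ.
  module DividedDifference (v : Fin m) (a : Poly) where

    σ-var ∂-var : Fin m → Poly
    σ-var i = if does (i ≟ v) then a else var i
    ∂-var i = if does (i ≟ v) then con R.1# else con R.0#

    σ : Poly → Poly
    σ = subst σ-var

    σ-cong : ∀ {p q} → p ≋ q → σ p ≋ σ q
    σ-cong = subst-cong σ-var

    ∂ : Poly → Poly
    ∂ (con _) = con R.0#
    ∂ (var i) = ∂-var i
    ∂ (p ⊕ q) = ∂ p ⊕ ∂ q
    ∂ (p ⊗ q) = ∂ p ⊗ q ⊕ σ p ⊗ ∂ q
    ∂ (⊝ p)   = ⊝ ∂ p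

    h : Poly
    h = var v ⊕ ⊝ a

    -- p = σ p + (Xᵥ − a) ∂ p
    decompose : ∀ p → p ≋ σ p ⊕ h ⊗ ∂ p
    decompose (con x) = P.sym (P.trans (P.+-congˡ (P.zeroʳ h)) (P.+-identityʳ _))
    decompose (var i) with i ≟ v
    ... | yes ≡.refl = P.sym (begin
      a ⊕ h ⊗ con R.1#     ≈⟨ P.+-congˡ (P.*-identityʳ h) ⟩
      a ⊕ (var v ⊕ ⊝ a)    ≈⟨ P.+-comm _ _ ⟩
      var v ⊕ ⊝ a ⊕ a      ≈⟨ P.+-assoc _ _ _ ⟩
      var v ⊕ (⊝ a ⊕ a)    ≈⟨ P.+-congˡ (P.-‿inverseˡ a) ⟩
      var v ⊕ con R.0#     ≈⟨ P.+-identityʳ _ ⟩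
      var v                ∎)
    ... | no  _ = P.sym (P.trans (P.+-congˡ (P.zeroʳ h)) (P.+-identityʳ _))
    decompose (p ⊕ q) = P.trans (⊕-cong (decompose p) (decompose q))
                                (I.∂-+ (σ p) (σ q) h (∂ p) (∂ q))
    decompose (p ⊗ q) = begin
      p ⊗ q                                   ≈⟨ P.*-congʳ (decompose p) ⟩
      (σ p ⊕ h ⊗ ∂ p) ⊗ q                     ≈⟨ P.distribʳ _ _ _ ⟩
      σ p ⊗ q ⊕ h ⊗ ∂ p ⊗ q                   ≈⟨ P.+-congʳ (P.*-congˡ (decompose q)) ⟩
      σ p ⊗ (σ q ⊕ h ⊗ ∂ q) ⊕ h ⊗ ∂ p ⊗ q     ≈⟨ I.∂-* (σ p) (σ q) h (∂ p) (∂ q) q ⟩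
      σ p ⊗ σ q ⊕ h ⊗ (∂ p ⊗ q ⊕ σ p ⊗ ∂ q)   ∎
    decompose (⊝ p) = begin
      ⊝ p                      ≈⟨ ⊝-cong (decompose p) ⟩
      ⊝ (σ p ⊕ h ⊗ ∂ p)        ≈⟨ ⁻¹-∙-comm _ _ ⟨
      ⊝ σ p ⊕ ⊝ (h ⊗ ∂ p)      ≈⟨ P.+-congˡ (-‿distribʳ-* h (∂ p)) ⟩
      ⊝ σ p ⊕ h ⊗ (⊝ ∂ p)      ∎

    ∂-cong : ∀ {p q} → p ≋ q → ∂ p ≋ ∂ q
    ∂-cong ≋-refl          = ≋-refl
    ∂-cong (≋-sym e)       = ≋-sym (∂-cong e)
    ∂-cong (≋-trans e f)   = ≋-trans (∂-cong e) (∂-cong f)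
    ∂-cong (con-cong e)    = ≋-refl
    ∂-cong (con-+ x y)     = P.sym (P.+-identityˡ _)
    ∂-cong (con-* x y)     = P.sym (P.trans (⊕-cong (P.zeroˡ _) (P.zeroʳ _)) (P.+-identityˡ _))
    ∂-cong (⊕-cong e f)    = ⊕-cong (∂-cong e) (∂-cong f)
    ∂-cong (⊗-cong e f)    = ⊕-cong (⊗-cong (∂-cong e) f) (⊗-cong (σ-cong e) (∂-cong f))
    ∂-cong (⊝-cong e)      = ⊝-cong (∂-cong e)
    ∂-cong (⊕-assoc p q r) = ⊕-assoc _ _ _
    ∂-cong (⊕-comm p q)    = ⊕-comm _ _
    ∂-cong (⊕-idˡ p)       = ⊕-idˡ _
    ∂-cong (⊝-invˡ p)      = ⊝-invˡ _
    ∂-cong (⊗-assoc p q r) = I.∂-assoc (∂ p) q r (σ p) (∂ q) (σ q) (∂ r)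
    ∂-cong (⊗-comm p q)    = begin
      ∂ p ⊗ q ⊕ σ p ⊗ ∂ q                  ≈⟨ P.+-congʳ (P.*-congˡ (decompose q)) ⟩
      ∂ p ⊗ (σ q ⊕ h ⊗ ∂ q) ⊕ σ p ⊗ ∂ q    ≈⟨ I.∂-comm (∂ p) (σ q) h (∂ q) (σ p) ⟩
      ∂ q ⊗ (σ p ⊕ h ⊗ ∂ p) ⊕ σ q ⊗ ∂ p    ≈⟨ P.+-congʳ (P.*-congˡ (decompose p)) ⟨
      ∂ q ⊗ p ⊕ σ q ⊗ ∂ p                  ∎
    ∂-cong (⊗-idˡ p)       = P.trans (⊕-cong (P.zeroˡ _) (P.*-identityˡ _)) (P.+-identityˡ _)
    ∂-cong (⊗-distribˡ p q r) = I.∂-distrib (∂ p) q r (σ p) (∂ q) (∂ r)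

    ∂-var-self : ∂ (var v) ≋ con R.1#
    ∂-var-self with v ≟ v
    ... | yes _   = ≋-refl
    ... | no  v≢v = contradiction ≡.refl v≢v

    σ-var-self : σ (var v) ≋ a
    σ-var-self with v ≟ v
    ... | yes _   = ≋-refl
    ... | no  v≢v = contradiction ≡.refl v≢v

    h-regular : σ a ≋ a → ∂ a ≋ con R.0# → Regular h
    h-regular σa ∂a = regular λ p hp≈0 → begin
      p                                          ≈⟨ P.*-identityˡ p ⟨
      con R.1# ⊗ p                               ≈⟨ P.+-identityʳ _ ⟨
      con R.1# ⊗ p ⊕ con R.0#                    ≈⟨ ⊕-cong (P.*-congʳ ∂h) (σh⊗∂p p) ⟨
      ∂ h ⊗ p ⊕ σ h ⊗ ∂ p                        ≈⟨ ∂-cong hp≈0 ⟩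
      con R.0#                                   ∎
      where
      ∂h : ∂ h ≋ con R.1#
      ∂h = P.trans (⊕-cong ∂-var-self (P.trans (⊝-cong ∂a) ε⁻¹≈ε)) (P.+-identityʳ _)
      σh⊗∂p : ∀ p → σ h ⊗ ∂ p ≋ con R.0#
      σh⊗∂p p = P.trans (P.*-congʳ (P.trans (⊕-cong σ-var-self (⊝-cong σa)) (P.-‿inverseʳ a)))
                      (P.zeroˡ _)

  var-regular : ∀ v → Regular (var v)
  var-regular v = regular-cong
    (P.trans (P.+-congˡ ε⁻¹≈ε) (P.+-identityʳ _)) (h-regular ≋-refl ≋-refl)
    where open DividedDifference v (con R.0#)

  var-var-regular : ∀ i j → i ≢ j → Regular (var i ⊕ ⊝ var j)
  var-var-regular i j i≢j = h-regular σj ∂j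
    where
    open DividedDifference i (var j)
    σj : σ (var j) ≋ var j
    σj with j ≟ i
    ... | yes _ = ≋-refl
    ... | no  _ = ≋-refl
    ∂j : ∂ (var j) ≋ con R.0#
    ∂j with j ≟ i
    ... | yes j≡i = contradiction (≡.sym j≡i) i≢j
    ... | no  _   = ≋-refl

  1-var*-regular : ∀ v q → Regular (con R.1# ⊕ ⊝ (var v ⊗ q))
  1-var*-regular v q = regular λ p eq → descend (proj₁ (bound p)) p (proj₂ (bound p)) eq
    where
    open DividedDifference v (con R.0#)

    -- Degree in Xᵥ below d.
    Deg< : ℕ → Poly → Set (c ⊔ ℓ)
    Deg< zero    p = p ≋ con R.0#
    Deg< (suc d) p = Deg< d (∂ p)

    deg-cong : ∀ d {p q} → p ≋ q → Deg< d p → Deg< d q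
    deg-cong zero    e z = P.trans (P.sym e) z
    deg-cong (suc d) e z = deg-cong d (∂-cong e) z

    deg-0 : ∀ d → Deg< d (con R.0#)
    deg-0 zero    = ≋-refl
    deg-0 (suc d) = deg-0 d

    deg-suc : ∀ d p → Deg< d p → Deg< (suc d) p
    deg-suc zero    p z = ∂-cong z
    deg-suc (suc d) p z = deg-suc d (∂ p) z

    deg-mono : ∀ k d p → Deg< d p → Deg< (k ℕ.+ d) p
    deg-mono zero    d p z = z
    deg-mono (suc k) d p z = deg-suc (k ℕ.+ d) p (deg-mono k d p z)

    deg-⊕ : ∀ d p q → Deg< d p → Deg< d q → Deg< d (p ⊕ q)
    deg-⊕ zero    p q y z = P.trans (⊕-cong y z) (P.+-identityˡ _)
    deg-⊕ (suc d) p q y z = deg-⊕ d (∂ p) (∂ q) y z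

    deg-⊝ : ∀ d p → Deg< d p → Deg< d (⊝ p)
    deg-⊝ zero    p z = P.trans (⊝-cong z) ε⁻¹≈ε
    deg-⊝ (suc d) p z = deg-⊝ d (∂ p) z

    ∂σ-var : ∀ i → ∂ (σ-var i) ≋ con R.0#
    ∂σ-var i with i ≟ v in eq
    ... | yes _ = ≋-refl
    ... | no  _ rewrite eq = ≋-refl

    ∂σ : ∀ p → ∂ (σ p) ≋ con R.0#
    ∂σ (con x) = ≋-refl
    ∂σ (var i) = ∂σ-var i
    ∂σ (p ⊕ q) = P.trans (⊕-cong (∂σ p) (∂σ q)) (P.+-identityˡ _)
    ∂σ (p ⊗ q) = P.trans (⊕-cong (P.trans (P.*-congʳ (∂σ p)) (P.zeroˡ _))
                                 (P.trans (P.*-congˡ (∂σ q)) (P.zeroʳ _))) (P.+-identityˡ _)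
    ∂σ (⊝ p)   = P.trans (⊝-cong (∂σ p)) ε⁻¹≈ε

    σσ-var : ∀ i → σ (σ-var i) ≋ σ-var i
    σσ-var i with i ≟ v in eq
    ... | yes _ = ≋-refl
    ... | no  _ rewrite eq = ≋-refl

    σσ : ∀ p → σ (σ p) ≋ σ p
    σσ (con x) = ≋-refl
    σσ (var i) = σσ-var i
    σσ (p ⊕ q) = ⊕-cong (σσ p) (σσ q)
    σσ (p ⊗ q) = ⊗-cong (σσ p) (σσ q)
    σσ (⊝ p)   = ⊝-cong (σσ p)

    deg-σ⊗ : ∀ d p q → Deg< d q → Deg< d (σ p ⊗ q)
    deg-σ⊗ zero    p q z = P.trans (P.*-congˡ z) (P.zeroʳ _)
    deg-σ⊗ (suc d) p q z = deg-cong d (P.sym ∂-σ⊗) (deg-σ⊗ d p (∂ q) z)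
      where
      ∂-σ⊗ : ∂ (σ p ⊗ q) ≋ σ p ⊗ ∂ q
      ∂-σ⊗ = P.trans (⊕-cong (P.trans (P.*-congʳ (∂σ p)) (P.zeroˡ _)) (P.*-congʳ (σσ p)))
                     (P.+-identityˡ _)

    deg-⊗ : ∀ d e p q → Deg< d p → Deg< e q → Deg< (d ℕ.+ e) (p ⊗ q)
    deg-⊗ zero    e p q y z = deg-cong e (P.sym (P.trans (P.*-congʳ y) (P.zeroˡ _))) (deg-0 e)
    deg-⊗ (suc d) e p q y z = deg-⊕ (d ℕ.+ e) _ _ (deg-⊗ d e (∂ p) q y z)
      (deg-pred (deg-σ⊗ (suc (d ℕ.+ e)) p q (deg-mono (suc d) e q z)))
      where
      deg-pred : Deg< (d ℕ.+ e) (∂ (σ p ⊗ q)) → Deg< (d ℕ.+ e) (σ p ⊗ ∂ q)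
      deg-pred = deg-cong (d ℕ.+ e)
        (P.trans (⊕-cong (P.trans (P.*-congʳ (∂σ p)) (P.zeroˡ _)) (P.*-congʳ (σσ p)))
                 (P.+-identityˡ _))

    bound : ∀ p → ∃ λ d → Deg< d p
    bound (con x) = 1 , ≋-refl
    bound (var i) = 2 , deg-var
      where
      deg-var : ∂ (∂-var i) ≋ con R.0#
      deg-var with i ≟ v
      ... | yes _ = ≋-refl
      ... | no  _ = ≋-refl
    bound (p ⊕ q) with bound p | bound q
    ... | d , y | e , z = d ℕ.+ e , deg-⊕ (d ℕ.+ e) p q
      (≡.subst (λ k → Deg< k p) (ℕₚ.+-comm e d) (deg-mono e d p y)) (deg-mono d e q z)
    bound (p ⊗ q) with bound p | bound q
    ... | d , y | e , z = d ℕ.+ e , deg-⊗ d e p q y z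
    bound (⊝ p) with bound p
    ... | d , y = d , deg-⊝ d p y

    u : Poly
    u = con R.1# ⊕ ⊝ (var v ⊗ q)

    descend : ∀ d p → Deg< d p → u ⊗ p ≋ con R.0# → p ≋ con R.0#
    descend zero    p z eq = z
    descend (suc d) p z eq = begin
      p                 ≈⟨ p≈v∂p ⟩
      var v ⊗ ∂ p       ≈⟨ P.*-congˡ (descend d (∂ p) z u∂p≈0) ⟩
      var v ⊗ con R.0#  ≈⟨ P.zeroʳ _ ⟩
      con R.0#          ∎
      where
      σu : σ u ≋ con R.1#
      σu = P.trans (P.+-congˡ (P.trans (⊝-cong (P.trans (P.*-congʳ σ-var-self) (P.zeroˡ _))) ε⁻¹≈ε))
                   (P.+-identityʳ _)
      σp≈0 : σ p ≋ con R.0#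
      σp≈0 = P.trans (P.sym (P.*-identityˡ _)) (P.trans (P.*-congʳ (P.sym σu)) (σ-cong eq))
      p≈v∂p : p ≋ var v ⊗ ∂ p
      p≈v∂p = P.trans (decompose p) (P.trans (⊕-cong σp≈0
        (P.*-congʳ (P.trans (P.+-congˡ ε⁻¹≈ε) (P.+-identityʳ _)))) (P.+-identityˡ _))
      u∂p≈0 : u ⊗ ∂ p ≋ con R.0#
      u∂p≈0 = annihilated (var-regular v) (u ⊗ ∂ p) (begin
        var v ⊗ (u ⊗ ∂ p)  ≈⟨ P.*-assoc _ _ _ ⟨
        var v ⊗ u ⊗ ∂ p    ≈⟨ P.*-congʳ (P.*-comm _ _) ⟩
        u ⊗ var v ⊗ ∂ p    ≈⟨ P.*-assoc _ _ _ ⟩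
        u ⊗ (var v ⊗ ∂ p)  ≈⟨ P.*-congˡ p≈v∂p ⟨
        u ⊗ p              ≈⟨ eq ⟩
        con R.0#           ∎)

------------------------------------------------------------------------
-- The total ring of fractions: denominators are the non-zero-divisors, so
-- for an integral domain this is the field of fractions.

module Fractions (A : CommutativeRing c ℓ) where
  open CommutativeRing A
  private module I = Identities A
  open RingNotation A using (Regular; regular; annihilated; regular-1; regular-*; regular-cancel)
  open SetoidReasoning setoid

  -- No η and copattern definitions of the operations: otherwise they would
  -- be unfolded, regularity proofs included, during conversion checking.
  record Frac : Set (c ⊔ ℓ) where
    no-eta-equality
    field
      num den     : Carrier
      den-regular : Regular den
  open Frac public

  infix  4 _≈F_
  infixl 6 _+F_
  infixl 7 _*F_ _/F_[_]

  record _≈F_ (x y : Frac) : Set ℓ where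
    constructor cross
    field cross-eq : num x * den y ≈ num y * den x
  open _≈F_ public

  ι : Carrier → Frac
  ι a .num         = a
  ι a .den         = 1#
  ι a .den-regular = regular-1

  _+F_ _*F_ : Frac → Frac → Frac
  (x +F y) .num         = num x * den y + num y * den x
  (x +F y) .den         = den x * den y
  (x +F y) .den-regular = regular-* (den-regular x) (den-regular y)
  (x *F y) .num         = num x * num y
  (x *F y) .den         = den x * den y
  (x *F y) .den-regular = regular-* (den-regular x) (den-regular y)

  -F_ : Frac → Frac
  (-F x) .num         = - num x
  (-F x) .den         = den x
  (-F x) .den-regular = den-regular x

  private
    ≈F-trans : ∀ {x y z} → x ≈F y → y ≈F z → x ≈F z
    ≈F-trans {x} {y} {z} (cross e) (cross f) = cross (regular-cancel (den-regular y) _ _ (begin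
      den y * (num x * den z)  ≈⟨ I.trans₁ (den y) (num x) (den z) ⟩
      (num x * den y) * den z  ≈⟨ *-congʳ e ⟩
      (num y * den x) * den z  ≈⟨ I.trans₂ (num y) (den x) (den z) ⟩
      (num y * den z) * den x  ≈⟨ *-congʳ f ⟩
      (num z * den y) * den x  ≈⟨ I.trans₃ (num z) (den y) (den x) ⟩
      den y * (num z * den x)  ∎))

    +F-cong : ∀ {x x′ y y′} → x ≈F x′ → y ≈F y′ → x +F y ≈F x′ +F y′
    +F-cong {x} {x′} {y} {y′} (cross e) (cross f) = cross (begin
      (num x * den y + num y * den x) * (den x′ * den y′)
        ≈⟨ I.cong₁ (num x) (den y) (num y) (den x) (den x′) (den y′) ⟩
      (num x * den x′) * (den y * den y′) + (num y * den y′) * (den x * den x′)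
        ≈⟨ +-cong (*-congʳ e) (*-congʳ f) ⟩
      (num x′ * den x) * (den y * den y′) + (num y′ * den y) * (den x * den x′)
        ≈⟨ I.cong₂ (num x′) (den x) (den y) (den y′) (num y′) (den x′) ⟩
      (num x′ * den y′ + num y′ * den x′) * (den x * den y) ∎)

    *F-cong : ∀ {x x′ y y′} → x ≈F x′ → y ≈F y′ → x *F y ≈F x′ *F y′
    *F-cong {x} {x′} {y} {y′} (cross e) (cross f) = cross (begin
      (num x * num y) * (den x′ * den y′)    ≈⟨ I.interchange (num x) (num y) (den x′) (den y′) ⟩
      (num x * den x′) * (num y * den y′)    ≈⟨ *-cong e f ⟩
      (num x′ * den x) * (num y′ * den y)    ≈⟨ I.interchange (num x′) (den x) (num y′) (den y) ⟩
      (num x′ * num y′) * (den x * den y)    ∎)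

    -F-cong : ∀ {x y} → x ≈F y → -F x ≈F -F y
    -F-cong {x} {y} (cross e) = cross (begin
      - num x * den y    ≈⟨ -‿distribˡ-* _ _ ⟨
      - (num x * den y)  ≈⟨ -‿cong e ⟩
      - (num y * den x)  ≈⟨ -‿distribˡ-* _ _ ⟩
      - num y * den x    ∎)
      where open RingProperties (CommutativeRing.ring A) using (-‿distribˡ-*)

    +F-assoc : ∀ x y z → (x +F y) +F z ≈F x +F (y +F z)
    +F-assoc x y z = cross (I.+-assoc-frac (num x) (den x) (num y) (den y) (num z) (den z))

    +F-comm : ∀ x y → x +F y ≈F y +F x
    +F-comm x y = cross (I.+-comm-frac (num x) (den x) (num y) (den y))

    +F-idˡ : ∀ x → ι 0# +F x ≈F x
    +F-idˡ x = cross (begin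
      (0# * den x + num x * 1#) * den x ≈⟨ *-congʳ (+-cong (zeroˡ _) (*-identityʳ _)) ⟩
      (0# + num x) * den x              ≈⟨ *-cong (+-identityˡ _) (sym (*-identityˡ _)) ⟩
      num x * (1# * den x)              ∎)

    -F-invˡ : ∀ x → -F x +F x ≈F ι 0#
    -F-invˡ x = cross (begin
      (- num x * den x + num x * den x) * 1#  ≈⟨ *-identityʳ _ ⟩
      - num x * den x + num x * den x         ≈⟨ distribʳ _ _ _ ⟨
      (- num x + num x) * den x               ≈⟨ *-congʳ (-‿inverseˡ _) ⟩
      0# * den x                              ≈⟨ zeroˡ _ ⟩
      0#                                      ≈⟨ zeroˡ _ ⟨
      0# * (den x * den x)                    ∎)

    *F-assoc : ∀ x y z → (x *F y) *F z ≈F x *F (y *F z)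
    *F-assoc x y z = cross (*-cong (*-assoc _ _ _) (sym (*-assoc _ _ _)))

    *F-comm : ∀ x y → x *F y ≈F y *F x
    *F-comm x y = cross (*-cong (*-comm _ _) (*-comm _ _))

    *F-idˡ : ∀ x → ι 1# *F x ≈F x
    *F-idˡ x = cross (*-cong (*-identityˡ _) (sym (*-identityˡ _)))

    *F-distribˡ : ∀ x y z → x *F (y +F z) ≈F (x *F y) +F (x *F z)
    *F-distribˡ x y z = cross (I.distrib-frac (num x) (den x) (num y) (den y) (num z) (den z))

  fractionRing : CommutativeRing (c ⊔ ℓ) ℓ
  fractionRing = record
    { Carrier = Frac
    ; _≈_ = _≈F_
    ; _+_ = _+F_
    ; _*_ = _*F_
    ; -_  = -F_
    ; 0#  = ι 0#
    ; 1#  = ι 1#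
    ; isCommutativeRing = record
      { isRing = record
        { +-isAbelianGroup = record
          { isGroup = record
            { isMonoid = record
              { isSemigroup = record
                { isMagma = record
                  { isEquivalence = record
                    { refl  = cross refl
                    ; sym   = λ (cross e) → cross (sym e)
                    ; trans = ≈F-trans
                    }
                  ; ∙-cong = +F-cong
                  }
                ; assoc = +F-assoc
                }
              ; identity = +F-idˡ , λ x → ≈F-trans (+F-comm _ _) (+F-idˡ x)
              }
            ; inverse = -F-invˡ , λ x → ≈F-trans (+F-comm x (-F x)) (-F-invˡ x)
            ; ⁻¹-cong = -F-cong
            }
          ; comm = +F-comm
          }
        ; *-cong = *F-cong
        ; *-assoc = *F-assoc
        ; *-identity = *F-idˡ , λ x → ≈F-trans (*F-comm _ _) (*F-idˡ x)
        ; distrib = *F-distribˡ , λ x y z → ≈F-trans (*F-comm (y +F z) x)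
            (≈F-trans (*F-distribˡ x y z) (+F-cong (*F-comm x y) (*F-comm x z)))
        }
      ; *-comm = *F-comm
      }
    }

  open RingNotation fractionRing public using () renaming (Regular to RegularF; regular to regularF; annihilated to annihilatedF)

  num-regular : ∀ {x} → RegularF x → Regular (num x)
  num-regular {x} reg = regular λ b eq → begin
    b        ≈⟨ *-identityʳ b ⟨
    b * 1#   ≈⟨ cross-eq (annihilatedF reg (ι b) (cross (trans (*-congʳ eq) (trans (zeroˡ _) (sym (zeroˡ _)))))) ⟩
    0# * 1#  ≈⟨ zeroˡ _ ⟩
    0#       ∎

  frac-regular : ∀ {x} → Regular (num x) → RegularF x
  frac-regular {x} reg = regularF λ b (cross eq) →
    cross (trans (*-identityʳ _) (trans (num-b≈0 b eq) (sym (zeroˡ _))))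
    where
    num-b≈0 : ∀ b → num (x *F b) * 1# ≈ 0# * den (x *F b) → num b ≈ 0#
    num-b≈0 b eq = annihilated reg (num b) (trans (sym (*-identityʳ _)) (trans eq (zeroˡ _)))

  inv : ∀ x → RegularF x → Frac
  inv x reg .num         = den x
  inv x reg .den         = num x
  inv x reg .den-regular = num-regular reg

  _/F_[_] : Frac → ∀ y → RegularF y → Frac
  x /F y [ reg ] = x *F inv y reg

------------------------------------------------------------------------
-- Rational functions R(X₀,…,Xₘ₋₁)

module RationalFunction (R : CommutativeRing c ℓ) (m : ℕ) where
  private module R = CommutativeRing R
  open Polynomial R m public
  open Fractions ring public
  open RingNotation ring using (Regular; regular-cong)
  module F = CommutativeRing fractionRing

  X : Fin m → Frac
  X i = ι (var i)

  const : R.Carrier → Frac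
  const a = ι (con a)

  X-regular : ∀ i → RegularF (X i)
  X-regular i = frac-regular (var-regular i)

  X⁻¹ : Fin m → Frac
  X⁻¹ i = inv (X i) (X-regular i)

  -- (w f)(X₀,…,Xₘ₋₁) = f(X_{w(0)},…,X_{w(m-1)})
  infixr 7 _·_
  _·_ : Permutation′ m → Frac → Frac
  (w · f) .num         = rename (w ⟨$⟩ʳ_) (num f)
  (w · f) .den         = rename (w ⟨$⟩ʳ_) (den f)
  (w · f) .den-regular = rename-regular (w ⟨$⟩ʳ_) (w ⟨$⟩ˡ_)
    (λ _ → Perm.inverseˡ w) (λ _ → Perm.inverseʳ w) (den-regular f)

  -- The graph of the evaluation Xᵢ ↦ yᵢ, which is a partial function: f has
  -- a value only if it can be written as a fraction whose denominator does
  -- not become a zero divisor.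
  EvaluatesTo : (Fin m → R.Carrier) → Frac → R.Carrier → Set _
  EvaluatesTo y f v = ∃ λ g → f ≈F g × Regular′ (evalAt y (den g)) ×
                              evalAt y (num g) R.≈ v R.* evalAt y (den g)
    where open RingNotation R renaming (Regular to Regular′)

  EvaluatesTo-functional : ∀ {y f v v′} →
    EvaluatesTo y f v → EvaluatesTo y f v′ → v R.≈ v′
  EvaluatesTo-functional {y} {f} {v} {v′} (g , f≈g , rg , eg) (g′ , f≈g′ , rg′ , eg′) =
    regular-cancel (regular-* rg rg′) v v′ (begin
      (d R.* d′) R.* v          ≈⟨ I.value₁ d d′ v ⟩
      (v R.* d) R.* d′          ≈⟨ R.*-congʳ eg ⟨
      evalAt y (num g) R.* d′   ≈⟨ evalAt-cong y (cross-eq (F.trans (F.sym f≈g) f≈g′)) ⟩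
      evalAt y (num g′) R.* d   ≈⟨ R.*-congʳ eg′ ⟩
      (v′ R.* d′) R.* d         ≈⟨ I.value₂ v′ d′ d ⟩
      (d R.* d′) R.* v′         ∎)
    where
    module I = Identities R
    open RingNotation R using (regular-cancel; regular-*)
    open SetoidReasoning R.setoid
    d d′ : R.Carrier
    d  = evalAt y (den g)
    d′ = evalAt y (den g′)

  1-XᵢXⱼ⁻¹-regular : ∀ i j → i ≢ j → RegularF (F.1# F.- X i F.* X⁻¹ j)
  1-XᵢXⱼ⁻¹-regular i j i≢j = frac-regular (regular-cong
    (P.+-cong (P.sym (P.trans (P.*-identityˡ _) (P.*-identityˡ _)))
              (P.trans (P.-‿cong (P.sym (P.*-identityʳ _))) (P.sym (P.*-identityʳ _))))
    (var-var-regular j i (λ j≡i → i≢j (≡.sym j≡i))))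

  1-Xᵢ⁻¹Xⱼ-regular : ∀ i j → i ≢ j → RegularF (F.1# F.- X⁻¹ i F.* X j)
  1-Xᵢ⁻¹Xⱼ-regular i j i≢j = RingNotation.regular-cong fractionRing
    (F.+-congˡ (F.-‿cong (F.*-comm (X j) (X⁻¹ i))))
    (1-XᵢXⱼ⁻¹-regular j i (λ j≡i → i≢j (≡.sym j≡i)))

------------------------------------------------------------------------
-- The field K(t^½), for an arbitrary field K (in particular for ℂ), and the
-- c-functions

module CFunctions {c ℓ₁ ℓ₂} (K : HeytingField c ℓ₁ ℓ₂) where

  Kring : CommutativeRing c ℓ₁
  Kring = HeytingCommutativeRing.commutativeRing (HeytingField.heytingCommutativeRing K)

  module T = RationalFunction Kring 1

  𝕃ring : CommutativeRing (c ⊔ ℓ₁) (c ⊔ ℓ₁)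
  𝕃ring = T.fractionRing

  module 𝕃 = CommutativeRing 𝕃ring
  open 𝕃 using () renaming (Carrier to 𝕃) public
  open RingNotation 𝕃ring using (_^_; product; ∏<; sumS; Regular; regular-cong)

  t½ t½⁻¹ t : 𝕃
  t½   = T.X zero
  t½⁻¹ = T.X⁻¹ zero
  t    = t½ ^ 2

  -- k ↦ t^{k/2}
  t½^ : ℤ → 𝕃
  t½^ (+ k)    = t½ ^ k
  t½^ -[1+ k ] = t½⁻¹ ^ suc k

  t½^-ι : ∀ k → t½ ^ k 𝕃.≈ T.ι (RingNotation._^_ T.ring (T.var zero) k)
  t½^-ι zero    = 𝕃.refl
  t½^-ι (suc k) = 𝕃.trans (𝕃.*-congˡ (t½^-ι k))
    (T.cross (T.P.*-congˡ (T.P.sym (T.P.*-identityˡ _))))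

  1-t^-regular : ∀ k → 0 ℕ.< k → Regular (𝕃.1# 𝕃.- t ^ k)
  1-t^-regular (suc k) _ = regular-cong
    (𝕃.+-congˡ {𝕃.1#} (𝕃.-‿cong (𝕃.sym (𝕃.trans (Exp.^-assocʳ 𝕃.semiring t½ 2 (suc k))
      (t½^-ι (2 ℕ.* suc k))))))
    (T.frac-regular (RingNotation.regular-cong T.ring
      (T.P.+-cong (T.P.sym (T.P.*-identityʳ _)) (T.P.sym (T.P.*-identityʳ _)))
      (T.1-var*-regular zero (RingNotation._^_ T.ring (T.var zero) (k ℕ.+ (suc k ℕ.+ 0))))))

  1-t-regular : Regular (𝕃.1# 𝕃.- t)
  1-t-regular = regular-cong {𝕃.1# 𝕃.- t ^ 1} (𝕃.+-congˡ {𝕃.1#} (𝕃.-‿cong (𝕃.*-identityʳ t)))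
                             (1-t^-regular 1 (ℕ.s≤s ℕ.z≤n))

  W₀ : ℕ → 𝕃
  W₀ n = sumS n λ w → t ^ length w

  [_]! : ℕ → 𝕃
  [ n ]! = product λ (d : Fin n) → (𝕃.1# 𝕃.- t ^ suc (toℕ d)) T./F (𝕃.1# 𝕃.- t) [ 1-t-regular ]

  -- ∏_{i<j} (1 - t^{j-i+1}) / (1 - t^{j-i})
  rootProduct : ℕ → 𝕃
  rootProduct n = ∏< n λ i j i<j →
    (𝕃.1# 𝕃.- t ^ (toℕ j ℕ.∸ toℕ i ℕ.+ 1)) T./F (𝕃.1# 𝕃.- t ^ (toℕ j ℕ.∸ toℕ i))
      [ 1-t^-regular (toℕ j ℕ.∸ toℕ i) (ℕₚ.m<n⇒0<n∸m i<j) ]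

  module _ (n : ℕ) where
    module 𝕃⟨X⟩ = RationalFunction 𝕃ring n
    open 𝕃⟨X⟩

    -- (t^{-½} - t^{½} z) / (1 - z)
    cFactor : (z : Frac) → RegularF (F.1# F.- z) → Frac
    cFactor z reg = (const t½⁻¹ F.- const t½ F.* z) /F (F.1# F.- z) [ reg ]

    open RingNotation fractionRing using () renaming (∏< to ∏<F)

    -- The variables are the xᵢ in cX⁻¹ and the Yᵢ in cY.
    cX⁻¹ cY : Frac
    cX⁻¹ = ∏<F n λ i j i<j → cFactor (X⁻¹ i F.* X j) (1-Xᵢ⁻¹Xⱼ-regular i j (Finₚ.<⇒≢ i<j))
    cY   = ∏<F n λ i j i<j → cFactor (X i F.* X⁻¹ j) (1-XᵢXⱼ⁻¹-regular i j (Finₚ.<⇒≢ i<j))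

    -- Yᵢ ↦ t^{-(i-1)+½(n-1)}; here toℕ i is i - 1.
    ev₀-point : Fin n → 𝕃
    ev₀-point i = t½^ ((+ n ℤ.- + 1) ℤ.- + 2 ℤ.* + toℕ i)

    ev₀ : Frac → 𝕃 → Set _
    ev₀ = EvaluatesTo ev₀-point

    ∑w·cX⁻¹ : Frac
    ∑w·cX⁻¹ = RingNotation.sumS fractionRing n λ w → w · cX⁻¹

{-# OPTIONS --safe #-}
-- Writing (t^{-½} - t^{½} xᵢ⁻¹xⱼ)/(1 - xᵢ⁻¹xⱼ) = t^{-½} (xᵢ - t xⱼ)/(xᵢ - xⱼ) and
-- splitting w ∈ Sₙ into w(0) = k and a permutation of the remaining indices, the
-- sum over Sₙ of w ∏_{i<j} (xᵢ - t xⱼ)/(xᵢ - xⱼ) acquires the factor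
-- ∑ₖ ∏_{j≠k} (xₖ - t xⱼ)/(xₖ - xⱼ). The partial fraction expansion
--   ∏ⱼ (z - t xⱼ)/(z - xⱼ) = 1 + ∑ₖ (xₖ - t xₖ)/(z - xₖ) ∏_{j≠k} (xₖ - t xⱼ)/(xₖ - xⱼ)
-- at z = 0 shows that this factor is (1 - tⁿ)/(1 - t). The same splitting turns
-- W₀(t) into ∏ (1 - tᵈ)/(1 - t), since it lowers the length by k, and each row of
-- ∏_{i<j} (1 - t^{j-i+1})/(1 - t^{j-i}) telescopes to the same quotients. Finally
-- Yᵢ Yⱼ⁻¹ evaluates to t^{j-i}.

module Submission where

open import Defs
open import Level using (Level)
open import Algebra.Apartness.Bundles using (HeytingField)
open import Algebra.Bundles using (CommutativeMonoid; CommutativeRing)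
open import Algebra.Morphism.Structures using (IsRingHomomorphism)
import Algebra.Properties.AbelianGroup as AbelianGroupProperties
import Algebra.Properties.CommutativeMonoid.Sum as CommutativeMonoidSum
import Algebra.Properties.CommutativeSemigroup as CommutativeSemigroupProperties
import Algebra.Properties.CommutativeSemiring.Exp as Exp
import Algebra.Properties.Monoid.Mult as MonoidMult
import Algebra.Properties.Ring as RingProperties
import Algebra.Properties.Semiring.Sum as SemiringSum
import Algebra.Solver.Ring.NaturalCoefficients.Default as NatSolver
open import Data.Bool.Base using (if_then_else_; _∧_)
open import Data.Fin.Base using (Fin; zero; suc; toℕ; punchIn; fromℕ; inject₁) renaming (_<_ to _<ᶠ_)
open import Data.Fin.Permutation as Perm using (Permutation′; _⟨$⟩ʳ_; _⟨$⟩ˡ_; insert; remove)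
open import Data.Fin.Properties as Finₚ using (_<?_; _≟_)
open import Data.Integer.Base as ℤ using (+_; _⊖_)
import Data.Integer.Properties as ℤₚ
open import Data.List.Base using (List; []; _∷_; _++_; foldr; map; tabulate; cartesianProductWith)
import Data.List.Properties as Listₚ
open import Data.Nat.Base as ℕ using (ℕ; zero; suc; z≤n; s≤s; s≤s⁻¹; _≥_)
import Data.Nat.Properties as ℕₚ
open import Data.Product.Base using (_×_; _,_)
open import Function.Base using (_∘_; id)
open import Relation.Binary.PropositionalEquality as ≡ using (_≡_; _≢_)
import Relation.Binary.Reasoning.Setoid as SetoidReasoning
open import Relation.Nullary using (¬_; Dec; yes; no; does; contradiction)
open import Relation.Nullary.Decidable using (dec-true; dec-false)

-- Permutations and lengths

⟨$⟩ʳ-≢ : ∀ {n} (w : Permutation′ n) {i j} → i ≢ j → w ⟨$⟩ʳ i ≢ w ⟨$⟩ʳ j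
⟨$⟩ʳ-≢ w i≢j wi≡wj = i≢j (≡.trans (≡.sym (Perm.inverseˡ w))
  (≡.trans (≡.cong (w ⟨$⟩ˡ_) wi≡wj) (Perm.inverseˡ w)))

-- The number n(n-1)/2 of pairs i < j in `Fin n`, which is the length of the longest element.
triangle : ℕ → ℕ
triangle zero    = zero
triangle (suc n) = n ℕ.+ triangle n

-- Combining values over pairs i < j in a commutative monoid

module UpperTriangle {c ℓ : Level} (M : CommutativeMonoid c ℓ) where
  open CommutativeMonoid M
  open CommutativeMonoidSum M using (sum; sum-cong-≋; sum-replicate; sum-replicate-zero; ∑-distrib-+; sum-permute;
    sum-init-last) public
  open MonoidMult monoid using (×-homo-+) renaming (_×_ to _·_)
  open CommutativeSemigroupProperties commutativeSemigroup using (interchange)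

  -- Splitting off row 0 matches `insert zero`. The monoid is abstract because its additive instance
  -- counts inversions and its multiplicative one forms products over i < j.
  upper : ∀ n → (Fin n → Fin n → Carrier) → Carrier
  upper zero    f = ε
  upper (suc n) f = sum (λ j → f zero (suc j)) ∙ upper n (λ i j → f (suc i) (suc j))

  upper-cong : ∀ n {f g : Fin n → Fin n → Carrier} →
               (∀ i j → i <ᶠ j → f i j ≈ g i j) → upper n f ≈ upper n g
  upper-cong zero    f≈g = refl
  upper-cong (suc n) f≈g = ∙-cong (sum-cong-≋ (λ j → f≈g zero (suc j) (s≤s z≤n)))
                                  (upper-cong n (λ i j i<j → f≈g (suc i) (suc j) (s≤s i<j)))

  upper-∙ : ∀ n (f g : Fin n → Fin n → Carrier) →
            upper n (λ i j → f i j ∙ g i j) ≈ upper n f ∙ upper n g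
  upper-∙ zero    f g = sym (identityˡ ε)
  upper-∙ (suc n) f g = trans (∙-cong (∑-distrib-+ {n} _ _) (upper-∙ n _ _)) (interchange _ _ _ _)

  upper-const : ∀ n x → upper n (λ _ _ → x) ≈ triangle n · x
  upper-const zero    x = refl
  upper-const (suc n) x = trans (∙-cong (sum-replicate n) (upper-const n x)) (sym (×-homo-+ x n (triangle n)))

  sum-ε : ∀ {n} (f : Fin n → Carrier) → (∀ i → f i ≈ ε) → sum f ≈ ε
  sum-ε {n} f f≈ε = trans (sum-cong-≋ f≈ε) (sum-replicate-zero n)

  -- Connects the full square arrays of `length` and `∏<`, whose entries outside i < j are neutral,
  -- with the row recursion: the corner and column 0 contribute `ε`.
  sum-sum≈upper : ∀ n (F f : Fin n → Fin n → Carrier) →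
                  (∀ i j → i <ᶠ j → F i j ≈ f i j) → (∀ i j → ¬ i <ᶠ j → F i j ≈ ε) →
                  sum (λ i → sum (F i)) ≈ upper n f
  sum-sum≈upper zero    F f F≈f F≈ε = refl
  sum-sum≈upper (suc n) F f F≈f F≈ε = ∙-cong
    (trans (∙-cong (F≈ε zero zero λ ()) (sum-cong-≋ λ j → F≈f zero (suc j) (s≤s z≤n))) (identityˡ _))
    (trans (sum-cong-≋ λ i → trans (∙-congʳ (F≈ε (suc i) zero λ ())) (identityˡ _))
           (sum-sum≈upper n _ _ (λ i j i<j → F≈f (suc i) (suc j) (s≤s i<j))
                                (λ i j i≮j → F≈ε (suc i) (suc j) (i≮j ∘ s≤s⁻¹))))

  -- Row 0 runs over all indices other than k, in an order given by π that does not affect the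
  -- result. The remaining rows agree by computation.
  upper-insert : ∀ n (f : Fin (suc n) → Fin (suc n) → Carrier) k (π : Permutation′ n) →
    upper (suc n) (λ i j → f (insert zero k π ⟨$⟩ʳ i) (insert zero k π ⟨$⟩ʳ j)) ≈
    sum (λ j → f k (punchIn k j)) ∙
      upper n (λ i j → f (punchIn k (π ⟨$⟩ʳ i)) (punchIn k (π ⟨$⟩ʳ j)))
  upper-insert n f k π = ∙-congʳ (sym (sum-permute (λ j → f k (punchIn k j)) π))

-- Inversions and the longest element

module ℕ+ = UpperTriangle ℕₚ.+-0-commutativeMonoid

exceeds : ∀ {n} → Fin n → Fin n → ℕ
exceeds a b = if does (b <? a) then 1 else 0

length≡upper : ∀ {n} (w : Permutation′ n) →
               length w ≡ ℕ+.upper n (λ i j → exceeds (w ⟨$⟩ʳ i) (w ⟨$⟩ʳ j))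
length≡upper {n} w = ℕ+.sum-sum≈upper n _ _
  -- `does` of `×-dec` computes to `∧`, so deciding i < j turns the inversion test into `exceeds`,
  -- and into 0 in the other case.
  (λ i j i<j → ≡.cong (λ x → if x ∧ does ((w ⟨$⟩ʳ j) <? (w ⟨$⟩ʳ i)) then 1 else 0) (dec-true (i <? j) i<j))
  (λ i j i≮j → ≡.cong (λ x → if x ∧ does ((w ⟨$⟩ʳ j) <? (w ⟨$⟩ʳ i)) then 1 else 0) (dec-false (i <? j) i≮j))

exceeds-punchIn : ∀ {n} k (a b : Fin n) → exceeds (punchIn k a) (punchIn k b) ≡ exceeds a b
exceeds-punchIn zero    a       b       = ≡.refl
exceeds-punchIn (suc k) zero    zero    = ≡.refl
exceeds-punchIn (suc k) zero    (suc b) = ≡.refl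
exceeds-punchIn (suc k) (suc a) zero    = ≡.refl
exceeds-punchIn (suc k) (suc a) (suc b) = exceeds-punchIn k a b

-- `punchIn k` enumerates the indices other than k, and exactly those below k are counted.
sum-exceeds : ∀ {n} (k : Fin (suc n)) → ℕ+.sum (λ j → exceeds k (punchIn k j)) ≡ toℕ k
sum-exceeds {n} zero        = ℕ+.sum-ε {n} _ λ _ → ≡.refl
sum-exceeds {suc n} (suc k) = ≡.cong suc (sum-exceeds k)

-- Position 0 is inverted with each of the `toℕ k` smaller values. On the other positions
-- `punchIn k` preserves the order, which leaves the inversions of π.
length-insert : ∀ {n} k (π : Permutation′ n) → length (insert zero k π) ≡ toℕ k ℕ.+ length π
length-insert {n} k π = begin
  length (insert zero k π)
    ≡⟨ length≡upper (insert zero k π) ⟩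
  ℕ+.upper (suc n) (λ i j → exceeds (insert zero k π ⟨$⟩ʳ i) (insert zero k π ⟨$⟩ʳ j))
    ≡⟨ ℕ+.upper-insert n exceeds k π ⟩
  ℕ+.sum (λ j → exceeds k (punchIn k j)) ℕ.+
    ℕ+.upper n (λ i j → exceeds (punchIn k (π ⟨$⟩ʳ i)) (punchIn k (π ⟨$⟩ʳ j)))
    ≡⟨ ≡.cong₂ ℕ._+_ (sum-exceeds k) (ℕ+.upper-cong n λ i j _ → exceeds-punchIn k _ _) ⟩
  toℕ k ℕ.+ ℕ+.upper n (λ i j → exceeds (π ⟨$⟩ʳ i) (π ⟨$⟩ʳ j))
    ≡⟨ ≡.cong (toℕ k ℕ.+_) (length≡upper π) ⟨
  toℕ k ℕ.+ length π ∎
  where open ≡.≡-Reasoning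

length-cong : ∀ {n} {w v : Permutation′ n} → w Perm.≈ v → length w ≡ length v
length-cong {n} {w} {v} w≈v = begin
  length w                                                ≡⟨ length≡upper w ⟩
  ℕ+.upper n (λ i j → exceeds (w ⟨$⟩ʳ i) (w ⟨$⟩ʳ j))      ≡⟨ ℕ+.upper-cong n (λ i j _ → ≡.cong₂ exceeds (w≈v i) (w≈v j)) ⟩
  ℕ+.upper n (λ i j → exceeds (v ⟨$⟩ʳ i) (v ⟨$⟩ʳ j))      ≡⟨ length≡upper v ⟨
  length v                                                ∎
  where open ≡.≡-Reasoning

length≤triangle : ∀ {n} (w : Permutation′ n) → length w ℕ.≤ triangle n
length≤triangle {zero}  w = z≤n
length≤triangle {suc n} w = begin
  length w
    ≡⟨ length-cong {w = insert zero k π} {w} (Perm.insert-remove zero w) ⟨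
  length (insert zero k π)
    ≡⟨ length-insert k π ⟩
  toℕ k ℕ.+ length π
    ≤⟨ ℕₚ.+-mono-≤ (Finₚ.toℕ≤pred[n] k) (length≤triangle π) ⟩
  n ℕ.+ triangle n ∎
  where
  open ℕₚ.≤-Reasoning
  k : Fin (suc n)
  k = w ⟨$⟩ʳ zero
  π : Permutation′ n
  π = remove zero w

-- Choosing the largest remaining value at each position makes every estimate in `length≤triangle`
-- an equality.
reversal : ∀ n → Permutation′ n
reversal zero    = Perm.id
reversal (suc n) = insert zero (fromℕ n) (reversal n)

length-reversal : ∀ n → length (reversal n) ≡ triangle n
length-reversal zero    = ≡.refl
length-reversal (suc n) = ≡.trans (length-insert (fromℕ n) (reversal n))
                                  (≡.cong₂ ℕ._+_ (Finₚ.toℕ-fromℕ n) (length-reversal n))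

-- Maximality only compares `w₀` with other permutations. Its length is pinned down by the upper
-- bound together with `reversal`, which attains it.
length-longest : ∀ {n} (w₀ : Permutation′ n) → IsLongest w₀ → length w₀ ≡ triangle n
length-longest {n} w₀ longest = ℕₚ.≤-antisym (length≤triangle w₀)
  (≡.subst (ℕ._≤ length w₀) (length-reversal n) (longest (reversal n)))

-- Sums over the symmetric group in a commutative ring

module RingLemmas {c ℓ : Level} (R : CommutativeRing c ℓ) where
  open CommutativeRing R hiding (zero)
  open RingNotation R
  open SetoidReasoning setoid
  open AbelianGroupProperties +-abelianGroup using (⁻¹-involutive)
  open RingProperties ring using (-‿distribˡ-*; -‿distribʳ-*)
  open SemiringSum semiring using (sum; sum-cong-≋; *-distribˡ-sum; *-distribʳ-sum; ∑-distrib-+)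
  open NatSolver commutativeSemiring using (solve; _:=_; _:+_; _:*_; con)
  open Exp commutativeSemiring using (^-congʳ; ^-homo-*)
  module ∏ = UpperTriangle *-commutativeMonoid

  -- Passing to a `g` that does not see the proof of i < j removes the regularity proofs from the
  -- product. The hypothesis covers every such proof, in particular the one returned by `<?`.
  ∏<≈upper : ∀ n (f : ∀ (i j : Fin n) → i <ᶠ j → Carrier) (g : Fin n → Fin n → Carrier) →
             (∀ i j i<j → f i j i<j ≈ g i j) → ∏< n f ≈ ∏.upper n g
  ∏<≈upper n f g f≈g = ∏.sum-sum≈upper n _ g below above
    where
    below : ∀ i j → i <ᶠ j → factorIf (f i j) (i <? j) ≈ g i j
    below i j i<j with i <? j
    ... | yes p   = f≈g i j p
    ... | no  i≮j = contradiction i<j i≮j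
    above : ∀ i j → ¬ i <ᶠ j → factorIf (f i j) (i <? j) ≈ 1#
    above i j i≮j with i <? j
    ... | yes i<j = contradiction i<j i≮j
    ... | no  _   = refl

  sumList : ∀ {a} {B : Set a} → (B → Carrier) → List B → Carrier
  sumList f xs = foldr _+_ 0# (map f xs)

  sumList-++ : ∀ {a} {B : Set a} (f : B → Carrier) xs ys →
               sumList f (xs ++ ys) ≈ sumList f xs + sumList f ys
  sumList-++ f []       ys = sym (+-identityˡ _)
  sumList-++ f (x ∷ xs) ys = trans (+-congˡ (sumList-++ f xs ys)) (sym (+-assoc _ _ _))

  sumList-cong : ∀ {a} {B : Set a} {f g : B → Carrier} → (∀ x → f x ≈ g x) →
                 ∀ xs → sumList f xs ≈ sumList g xs
  sumList-cong f≈g []       = refl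
  sumList-cong f≈g (x ∷ xs) = +-cong (f≈g x) (sumList-cong f≈g xs)

  sumList-*ˡ : ∀ {a} {B : Set a} x (f : B → Carrier) xs →
               sumList (λ b → x * f b) xs ≈ x * sumList f xs
  sumList-*ˡ x f []       = sym (zeroʳ x)
  sumList-*ˡ x f (b ∷ xs) = trans (+-congˡ (sumList-*ˡ x f xs)) (sym (distribˡ x _ _))

  sumList-cartesianProductWith : ∀ {a b d} {A : Set a} {B : Set b} {D : Set d}
    (F : D → Carrier) (g : A → B → D) {n} (h : Fin n → A) ys →
    sumList F (cartesianProductWith g (tabulate h) ys) ≈ sum (λ i → sumList (F ∘ g (h i)) ys)
  sumList-cartesianProductWith F g {zero}  h ys = refl
  sumList-cartesianProductWith F g {suc n} h ys = trans
    (sumList-++ F (map (g (h zero)) ys) _)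
    (+-cong (reflexive (≡.cong (foldr _+_ 0#) (≡.sym (Listₚ.map-∘ ys))))
            (sumList-cartesianProductWith F g (h ∘ suc) ys))

  -- The recursion behind both `sumS-^length` and `symmetrization`: first choose k = w(0), then a
  -- permutation of the rest.
  sumS-suc : ∀ n (F : Permutation′ (suc n) → Carrier) →
             sumS (suc n) F ≈ sum (λ k → sumS n (F ∘ insert zero k))
  sumS-suc n F = sumList-cartesianProductWith F (insert zero) id (S n)

  -x*-y≈x*y : ∀ x y → - x * - y ≈ x * y
  -x*-y≈x*y x y = begin
    - x * - y      ≈⟨ -‿distribˡ-* x (- y) ⟨
    - (x * - y)    ≈⟨ -‿cong (-‿distribʳ-* x y) ⟨
    - - (x * y)    ≈⟨ ⁻¹-involutive (x * y) ⟩
    x * y          ∎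

  -- Quantum integers and factorials

  geometric : Carrier → ℕ → Carrier
  geometric τ n = sum {n} λ i → τ ^ toℕ i

  -- The common value to which every expression of the theorem is reduced, up to a power of t^(1/2).
  -- As a polynomial in τ it needs no division.
  qFactorial : Carrier → ℕ → Carrier
  qFactorial τ zero    = 1#
  qFactorial τ (suc n) = geometric τ (suc n) * qFactorial τ n

  geometric-sum : ∀ τ n → (1# - τ) * geometric τ n ≈ 1# - τ ^ n
  geometric-sum τ zero    = trans (zeroʳ _) (sym (-‿inverseʳ 1#))
  geometric-sum τ (suc n) = begin
    (1# - τ) * (1# + sum {n} (λ i → τ * τ ^ toℕ i))
      ≈⟨ *-congˡ (+-congˡ (*-distribˡ-sum {n} τ (λ i → τ ^ toℕ i))) ⟨
    (1# - τ) * (1# + τ * geometric τ n)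
      ≈⟨ solve 3 (λ d τ g → d :* (con 1 :+ τ :* g) := d :+ τ :* (d :* g)) refl (1# - τ) τ (geometric τ n) ⟩
    (1# - τ) + τ * ((1# - τ) * geometric τ n)
      ≈⟨ +-congˡ (*-congˡ (geometric-sum τ n)) ⟩
    (1# - τ) + τ * (1# - τ ^ n)
      ≈⟨ +-congˡ (trans (distribˡ τ 1# _) (+-cong (*-identityʳ τ) (sym (-‿distribʳ-* τ _)))) ⟩
    (1# - τ) + (τ - τ ^ suc n)
      ≈⟨ solve 4 (λ o m t p → (o :+ m) :+ (t :+ p) := (m :+ t) :+ (o :+ p)) refl 1# (- τ) τ (- τ ^ suc n) ⟩
    (- τ + τ) + (1# - τ ^ suc n)
      ≈⟨ trans (+-congʳ (-‿inverseˡ τ)) (+-identityˡ _) ⟩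
    1# - τ ^ suc n ∎

  sumS-^length : ∀ τ n → sumS n (λ w → τ ^ length w) ≈ qFactorial τ n
  sumS-^length τ zero    = +-identityʳ 1#
  sumS-^length τ (suc n) = begin
    sumS (suc n) (λ w → τ ^ length w)
      ≈⟨ sumS-suc n _ ⟩
    sum {suc n} (λ k → sumS n (λ π → τ ^ length (insert zero k π)))
      ≈⟨ sum-cong-≋ {suc n} (λ k → trans
           (sumList-cong (λ π → trans (^-congʳ τ (length-insert k π)) (^-homo-* τ (toℕ k) (length π))) (S n))
           (sumList-*ˡ (τ ^ toℕ k) (λ π → τ ^ length π) (S n))) ⟩
    sum {suc n} (λ k → τ ^ toℕ k * sumS n (λ π → τ ^ length π))
      ≈⟨ *-distribʳ-sum {suc n} (sumS n (λ π → τ ^ length π)) (λ k → τ ^ toℕ k) ⟨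
    geometric τ (suc n) * sumS n (λ π → τ ^ length π)
      ≈⟨ *-congˡ (sumS-^length τ n) ⟩
    qFactorial τ (suc n) ∎

  unit-cancel : ∀ {a u} → a * u ≈ 1# → ∀ {x y} → a * x ≈ a * y → x ≈ y
  unit-cancel {a} {u} au≈1 {x} {y} ax≈ay = begin
    x            ≈⟨ undo x ⟨
    u * (a * x)  ≈⟨ *-congˡ ax≈ay ⟩
    u * (a * y)  ≈⟨ undo y ⟩
    y            ∎
    where
    undo : ∀ z → u * (a * z) ≈ z
    undo z = trans (sym (*-assoc u a z)) (trans (*-congʳ (trans (*-comm u a) au≈1)) (*-identityˡ z))

  unit-regular : ∀ {a u} → a * u ≈ 1# → Regular a
  unit-regular au≈1 = regular λ b ab≈0 → unit-cancel au≈1 (trans ab≈0 (sym (zeroʳ _)))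

  inverse-unique : ∀ {a u v} → a * u ≈ 1# → a * v ≈ 1# → u ≈ v
  inverse-unique au≈1 av≈1 = unit-cancel au≈1 (trans au≈1 (sym av≈1))

  -- `h k` is the reciprocal of `g k`, so each factor is a quotient of consecutive values of `g`.
  telescope : ∀ n (g h : ℕ → Carrier) → (∀ k → g k * h k ≈ 1#) →
              g 0 * product {n} (λ j → g (suc (toℕ j)) * h (toℕ j)) ≈ g n
  telescope zero    g h gh≈1 = *-identityʳ _
  telescope (suc n) g h gh≈1 = begin
    g 0 * ((g 1 * h 0) * P)  ≈⟨ solve 4 (λ a b c p → a :* ((b :* c) :* p) := (a :* c) :* (b :* p)) refl (g 0) (g 1) (h 0) P ⟩
    (g 0 * h 0) * (g 1 * P)  ≈⟨ *-cong (gh≈1 0) (telescope n (g ∘ suc) (h ∘ suc) (gh≈1 ∘ suc)) ⟩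
    1# * g (suc n)           ≈⟨ *-identityˡ _ ⟩
    g (suc n)                ∎
    where P = product {n} (λ j → g (suc (suc (toℕ j))) * h (suc (toℕ j)))

  -- `v k` is 1/(1 - τ^(k+1)); the shift by one leaves out the exponent 0, where 1 - τ^0 = 0.
  module _ (τ : Carrier) (v : ℕ → Carrier) (v-inverse : ∀ k → (1# - τ ^ suc k) * v k ≈ 1#) where

    private
      1-τ-unit : (1# - τ) * v 0 ≈ 1#
      1-τ-unit = trans (*-congʳ (+-congˡ (-‿cong (sym (*-identityʳ τ))))) (v-inverse 0)

    -- This is row 0 of the root product. It telescopes to (1 - τ^(n+1))/(1 - τ), and cancelling 1 -
    -- τ gives a geometric sum.
    product-ratios : ∀ n → product {n} (λ j → (1# - τ ^ suc (suc (toℕ j))) * v (toℕ j)) ≈ geometric τ (suc n)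
    product-ratios n = unit-cancel (v-inverse 0) (begin
      (1# - τ ^ 1) * product {n} (λ j → (1# - τ ^ suc (suc (toℕ j))) * v (toℕ j))
        ≈⟨ telescope n (λ k → 1# - τ ^ suc k) v v-inverse ⟩
      1# - τ ^ suc n
        ≈⟨ geometric-sum τ (suc n) ⟨
      (1# - τ) * geometric τ (suc n)
        ≈⟨ *-congʳ (+-congˡ (-‿cong (*-identityʳ τ))) ⟨
      (1# - τ ^ 1) * geometric τ (suc n) ∎)

    -- (1 - τ^{j-i+1})/(1 - τ^{j-i}) for i < j; junk otherwise, because pred 0 = 0.
    rootFactor : ∀ {n} → Fin n → Fin n → Carrier
    rootFactor i j = (1# - τ ^ suc (toℕ j ℕ.∸ toℕ i)) * v (ℕ.pred (toℕ j ℕ.∸ toℕ i))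

    -- A factor depends only on j - i, so deleting row 0 leaves the same array of size n.
    upper-rootFactor : ∀ n → ∏.upper n rootFactor ≈ qFactorial τ n
    upper-rootFactor zero    = refl
    upper-rootFactor (suc n) = *-cong (product-ratios n) (upper-rootFactor n)

    product-qIntegers : ∀ n → product {n} (λ d → (1# - τ ^ suc (toℕ d)) * v 0) ≈ qFactorial τ n
    product-qIntegers zero    = refl
    product-qIntegers (suc n) = begin
      product {suc n} (λ d → (1# - τ ^ suc (toℕ d)) * v 0)
        -- `qFactorial` peels off its largest factor, so the product is split at its last index.
        ≈⟨ ∏.sum-init-last {n} (λ d → (1# - τ ^ suc (toℕ d)) * v 0) ⟩
      product {n} (λ d → (1# - τ ^ suc (toℕ (inject₁ d))) * v 0) * ((1# - τ ^ suc (toℕ (fromℕ n))) * v 0)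
        ≈⟨ *-cong (∏.sum-cong-≋ {n} (λ d → *-congʳ (+-congˡ (-‿cong (^-congʳ τ (≡.cong suc (Finₚ.toℕ-inject₁ d)))))))
                  (*-congʳ (+-congˡ (-‿cong (^-congʳ τ (≡.cong suc (Finₚ.toℕ-fromℕ n)))))) ⟩
      product {n} (λ d → (1# - τ ^ suc (toℕ d)) * v 0) * ((1# - τ ^ suc n) * v 0)
        ≈⟨ *-cong (product-qIntegers n) quotient ⟩
      qFactorial τ n * geometric τ (suc n)
        ≈⟨ *-comm _ _ ⟩
      qFactorial τ (suc n) ∎
      where
      quotient : (1# - τ ^ suc n) * v 0 ≈ geometric τ (suc n)
      quotient = begin
        (1# - τ ^ suc n) * v 0                   ≈⟨ *-congʳ (geometric-sum τ (suc n)) ⟨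
        (1# - τ) * geometric τ (suc n) * v 0     ≈⟨ solve 3 (λ a g u → a :* g :* u := (a :* u) :* g) refl (1# - τ) (geometric τ (suc n)) (v 0) ⟩
        (1# - τ) * v 0 * geometric τ (suc n)     ≈⟨ *-congʳ 1-τ-unit ⟩
        1# * geometric τ (suc n)                 ≈⟨ *-identityˡ _ ⟩
        geometric τ (suc n)                      ∎

  -- Partial fractions

  -- ∏_{j ≠ k} f k j
  others : ∀ n → (Fin n → Fin n → Carrier) → Fin n → Carrier
  others (suc n) f zero    = product {n} (λ j → f zero (suc j))
  others (suc n) f (suc k) = f (suc k) zero * others n (λ i j → f (suc i) (suc j)) k

  -- The recursion of `others` drops index 0, as the induction in `partialFractions` does; the
  -- `punchIn` form is the one that `upper-insert` produces.
  others≈punchIn : ∀ n (f : Fin (suc n) → Fin (suc n) → Carrier) k →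
                   others (suc n) f k ≈ product {n} (λ j → f k (punchIn k j))
  others≈punchIn n       f zero    = refl
  others≈punchIn (suc n) f (suc k) = *-congˡ (others≈punchIn n (λ i j → f (suc i) (suc j)) k)

  difference-+ : ∀ x y z → (x - y) + (y - z) ≈ x - z
  difference-+ x y z = begin
    (x - y) + (y - z)      ≈⟨ solve 4 (λ x m y p → (x :+ m) :+ (y :+ p) := (m :+ y) :+ (x :+ p)) refl x (- y) y (- z) ⟩
    (- y + y) + (x - z)    ≈⟨ trans (+-congʳ (-‿inverseˡ y)) (+-identityˡ _) ⟩
    x - z                  ∎

  difference-opposite : ∀ x y → (x - y) + (y - x) ≈ 0#
  difference-opposite x y = trans (difference-+ x y x) (-‿inverseʳ x)

  -- 1/(p(p+r)) = (1/r)(1/p - 1/(p+r)), with s = -r.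
  reciprocal-product : ∀ {p r s E e D D′} → r + s ≈ 0# →
    (p + r) * e ≈ 1# → p * E ≈ 1# → r * D ≈ 1# → s * D′ ≈ 1# →
    E * e ≈ E * D + D′ * e
  reciprocal-product {p} {r} {s} {E} {e} {D} {D′} r+s≈0 q-inv p-inv r-inv s-inv = sym (begin
    E * D + D′ * e
      ≈⟨ +-congʳ (trans (sym (*-identityʳ _)) (*-congˡ (sym q-inv))) ⟩
    E * D * ((p + r) * e) + D′ * e
      ≈⟨ solve 6 (λ E D p r e D′ → E :* D :* ((p :+ r) :* e) :+ D′ :* e
                   := (p :* E) :* (D :* e) :+ (r :* D) :* (E :* e) :+ D′ :* e) refl E D p r e D′ ⟩
    (p * E) * (D * e) + (r * D) * (E * e) + D′ * e
      ≈⟨ +-congʳ (+-cong (trans (*-congʳ p-inv) (*-identityˡ _)) (trans (*-congʳ r-inv) (*-identityˡ _))) ⟩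
    D * e + E * e + D′ * e
      ≈⟨ solve 4 (λ D e E D′ → D :* e :+ E :* e :+ D′ :* e := E :* e :+ (D :+ D′) :* e) refl D e E D′ ⟩
    E * e + (D + D′) * e
      ≈⟨ trans (+-congˡ (trans (*-congʳ D+D′≈0) (zeroˡ e))) (+-identityʳ _) ⟩
    E * e ∎)
    where
    D+D′≈0 : D + D′ ≈ 0#
    D+D′≈0 = begin
      D + D′                              ≈⟨ +-cong (*-identityʳ D) (*-identityʳ D′) ⟨
      D * 1# + D′ * 1#                    ≈⟨ +-cong (*-congˡ s-inv) (*-congˡ r-inv) ⟨
      D * (s * D′) + D′ * (r * D)         ≈⟨ solve 4 (λ D D′ r s → D :* (s :* D′) :+ D′ :* (r :* D) := D :* D′ :* (r :+ s)) refl D D′ r s ⟩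
      D * D′ * (r + s)                    ≈⟨ trans (*-congˡ r+s≈0) (zeroʳ _) ⟩
      0#                                  ∎

  -- Here d i j = 1/(yᵢ - yⱼ) and eᵢ = 1/(z - yᵢ).
  partialFractions : ∀ n (y a : Fin n → Carrier) (d : Fin n → Fin n → Carrier) →
    (∀ i j → i ≢ j → (y i - y j) * d i j ≈ 1#) →
    ∀ z (e : Fin n → Carrier) → (∀ i → (z - y i) * e i ≈ 1#) →
    product (λ j → (z - a j) * e j) ≈
    1# + sum (λ k → (y k - a k) * e k * others n (λ i j → (y i - a j) * d i j) k)
  partialFractions zero    y a d d-inv z e e-inv = sym (+-identityʳ 1#)
  partialFractions (suc n) y a d d-inv z e e-inv = begin
    (z - a zero) * e zero * product {n} (λ j → (z - a (suc j)) * e (suc j))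
      ≈⟨ *-cong head-factor (expansion z (e ∘ suc) (e-inv ∘ suc)) ⟩
    (1# + α * E) * (1# + sum {n} T)
      ≈⟨ solve 2 (λ x t → (con 1 :+ x) :* (con 1 :+ t) := con 1 :+ (x :+ (con 1 :+ x) :* t)) refl (α * E) (sum {n} T) ⟩
    1# + (α * E + (1# + α * E) * sum {n} T)
      ≈⟨ +-congˡ (+-congˡ (trans (*-distribˡ-sum {n} (1# + α * E) T) (sum-cong-≋ {n} termwise))) ⟩
    1# + (α * E + sum {n} (λ k → α * E * U k + V k))
      ≈⟨ +-congˡ (+-congˡ (trans (∑-distrib-+ {n} (λ k → α * E * U k) V) (+-congʳ (sym (*-distribˡ-sum {n} (α * E) U))))) ⟩
    1# + (α * E + (α * E * sum {n} U + sum {n} V))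
      ≈⟨ +-congˡ (solve 3 (λ x u v → x :+ (x :* u :+ v) := x :* (con 1 :+ u) :+ v) refl (α * E) (sum {n} U) (sum {n} V)) ⟩
    1# + (α * E * (1# + sum {n} U) + sum {n} V)
      -- A second use of the inductive hypothesis, now at the point `y zero`: it reassembles the
      -- coefficient of the new pole into a product.
      ≈⟨ +-congˡ (+-congʳ (*-congˡ (expansion (y zero) (λ i → d zero (suc i)) (λ i → d-inv zero (suc i) λ ())))) ⟨
    1# + (α * E * product {n} (λ j → (y zero - a (suc j)) * d zero (suc j)) + sum {n} V) ∎
    where
    α E : Carrier
    α = y zero - a zero
    E = e zero
    -- `T` and `U` are the terms of the shorter expansion at z and at `y zero`; `V` holds the terms
    -- of the longer expansion at z with index at least 1.
    o T U V : Fin n → Carrier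
    o = others n (λ i j → (y (suc i) - a (suc j)) * d (suc i) (suc j))
    T k = (y (suc k) - a (suc k)) * e (suc k) * o k
    U k = (y (suc k) - a (suc k)) * d zero (suc k) * o k
    V k = (y (suc k) - a (suc k)) * e (suc k) * ((y (suc k) - a zero) * d (suc k) zero * o k)

    expansion : ∀ z e → (∀ i → (z - y (suc i)) * e i ≈ 1#) →
      product {n} (λ j → (z - a (suc j)) * e j) ≈ 1# + sum {n} (λ k → (y (suc k) - a (suc k)) * e k * o k)
    expansion = partialFractions n (y ∘ suc) (a ∘ suc) (λ i j → d (suc i) (suc j))
      (λ i j i≢j → d-inv (suc i) (suc j) (i≢j ∘ Finₚ.suc-injective))

    head-factor : (z - a zero) * E ≈ 1# + α * E
    head-factor = begin
      (z - a zero) * E              ≈⟨ *-congʳ (difference-+ z (y zero) (a zero)) ⟨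
      ((z - y zero) + α) * E        ≈⟨ distribʳ E _ α ⟩
      (z - y zero) * E + α * E      ≈⟨ +-congʳ (e-inv zero) ⟩
      1# + α * E                    ∎

    -- `reciprocal-product` splits `E * e′`. Its part `E * D` yields the contribution to the pole at
    -- `y zero`; its part `D′ * e′` supplies the extra factor of `V k`.
    termwise : ∀ k → (1# + α * E) * T k ≈ α * E * U k + V k
    termwise k = begin
      (1# + α * E) * (r * e′ * o k)
        ≈⟨ solve 5 (λ α E r e o → (con 1 :+ α :* E) :* (r :* e :* o) := r :* e :* o :+ α :* r :* o :* (E :* e)) refl α E r e′ (o k) ⟩
      r * e′ * o k + α * r * o k * (E * e′)
        ≈⟨ +-congˡ (*-congˡ (reciprocal-product (difference-opposite (y zero) (y (suc k)))
             (trans (*-congʳ (difference-+ z (y zero) (y (suc k)))) (e-inv (suc k))) (e-inv zero)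
             (d-inv zero (suc k) λ ()) (d-inv (suc k) zero λ ()))) ⟩
      r * e′ * o k + α * r * o k * (E * D + D′ * e′)
        ≈⟨ solve 7 (λ α E r e o D D′ → r :* e :* o :+ α :* r :* o :* (E :* D :+ D′ :* e)
             := α :* E :* (r :* D :* o) :+ r :* e :* ((con 1 :+ α :* D′) :* o)) refl α E r e′ (o k) D D′ ⟩
      α * E * U k + r * e′ * ((1# + α * D′) * o k)
        ≈⟨ +-congˡ (*-congˡ (*-congʳ tail-factor)) ⟨
      α * E * U k + V k ∎
      where
      r e′ D D′ : Carrier
      r  = y (suc k) - a (suc k)
      e′ = e (suc k)
      D  = d zero (suc k)
      D′ = d (suc k) zero
      tail-factor : (y (suc k) - a zero) * D′ ≈ 1# + α * D′
      tail-factor = begin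
        (y (suc k) - a zero) * D′               ≈⟨ *-congʳ (difference-+ (y (suc k)) (y zero) (a zero)) ⟨
        ((y (suc k) - y zero) + α) * D′         ≈⟨ distribʳ D′ _ α ⟩
        (y (suc k) - y zero) * D′ + α * D′      ≈⟨ +-congʳ (d-inv (suc k) zero λ ()) ⟩
        1# + α * D′                             ∎

  -- Symmetrization of the product over i < j

  product-const : ∀ {n} (f : Fin n → Carrier) {x} → (∀ i → f i ≈ x) → product f ≈ x ^ n
  product-const {n} f {x} f≈x = trans (∏.sum-cong-≋ {n} f≈x) (∏.sum-replicate n)

  module _ (τ u : Carrier) (1-τ-unit : (1# - τ) * u ≈ 1#) where

    -- Evaluate the partial fraction expansion of ∏ (z - τ yⱼ)/(z - yⱼ) at z = 0.
    sum-others : ∀ n (y : Fin n → Carrier) (d : Fin n → Fin n → Carrier) →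
      (∀ i j → i ≢ j → (y i - y j) * d i j ≈ 1#) →
      (e : Fin n → Carrier) → (∀ i → y i * e i ≈ 1#) →
      sum (others n (λ i j → (y i - τ * y j) * d i j)) ≈ geometric τ n
    sum-others n y d d-inv e e-inv = unit-cancel 1-τ-unit (begin
      (1# - τ) * Σo
        ≈⟨ trans (+-congʳ (-‿inverseʳ (τ ^ n))) (+-identityˡ _) ⟨
      (τ ^ n - τ ^ n) + (1# - τ) * Σo
        -- Only the first τ^n is rewritten. At z = 0 each factor equals τ and each coefficient
        -- equals -(1 - τ), so the expansion reads τ^n = 1 - (1 - τ) Σo.
        ≈⟨ +-congʳ (+-congʳ (trans (sym (product-const {n} (λ j → (0# - τ * y j) * - e j) factor)) expansion)) ⟩
      (1# + - ((1# - τ) * Σo) - τ ^ n) + (1# - τ) * Σo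
        ≈⟨ solve 4 (λ o m p s → ((o :+ m) :+ p) :+ s := (o :+ p) :+ (m :+ s)) refl 1# (- ((1# - τ) * Σo)) (- τ ^ n) ((1# - τ) * Σo) ⟩
      (1# - τ ^ n) + (- ((1# - τ) * Σo) + (1# - τ) * Σo)
        ≈⟨ trans (+-congˡ (-‿inverseˡ _)) (+-identityʳ _) ⟩
      1# - τ ^ n
        ≈⟨ geometric-sum τ n ⟨
      (1# - τ) * geometric τ n ∎)
      where
      open RingProperties ring using (-1*x≈-x)
      o : Fin n → Carrier
      o = others n (λ i j → (y i - τ * y j) * d i j)
      Σo : Carrier
      Σo = sum {n} o

      -e-inv : ∀ i → (0# - y i) * - e i ≈ 1#
      -e-inv i = trans (*-congʳ (+-identityˡ _)) (trans (-x*-y≈x*y (y i) (e i)) (e-inv i))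

      factor : ∀ j → (0# - τ * y j) * - e j ≈ τ
      factor j = begin
        (0# - τ * y j) * - e j  ≈⟨ *-congʳ (+-identityˡ _) ⟩
        - (τ * y j) * - e j     ≈⟨ -x*-y≈x*y (τ * y j) (e j) ⟩
        τ * y j * e j           ≈⟨ *-assoc τ (y j) (e j) ⟩
        τ * (y j * e j)         ≈⟨ trans (*-congˡ (e-inv j)) (*-identityʳ τ) ⟩
        τ                       ∎

      term : ∀ k → (y k - τ * y k) * - e k ≈ - (1# - τ)
      term k = begin
        (y k - τ * y k) * - e k             ≈⟨ *-congʳ (+-cong (sym (*-identityˡ _)) (-‿distribˡ-* τ (y k))) ⟩
        (1# * y k + - τ * y k) * - e k      ≈⟨ *-congʳ (distribʳ (y k) 1# (- τ)) ⟨
        (1# - τ) * y k * - e k              ≈⟨ *-assoc (1# - τ) (y k) (- e k) ⟩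
        (1# - τ) * (y k * - e k)            ≈⟨ *-congˡ (-‿distribʳ-* (y k) (e k)) ⟨
        (1# - τ) * - (y k * e k)            ≈⟨ *-congˡ (-‿cong (e-inv k)) ⟩
        (1# - τ) * - 1#                     ≈⟨ trans (*-comm _ _) (-1*x≈-x _) ⟩
        - (1# - τ)                          ∎

      expansion : product {n} (λ j → (0# - τ * y j) * - e j) ≈ 1# + - ((1# - τ) * Σo)
      expansion = begin
        product {n} (λ j → (0# - τ * y j) * - e j)
          ≈⟨ partialFractions n y (λ j → τ * y j) d d-inv 0# (λ j → - e j) -e-inv ⟩
        1# + sum {n} (λ k → (y k - τ * y k) * - e k * o k)
          ≈⟨ +-congˡ (sum-cong-≋ {n} (λ k → *-congʳ (term k))) ⟩
        1# + sum {n} (λ k → - (1# - τ) * o k)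
          ≈⟨ +-congˡ (*-distribˡ-sum {n} (- (1# - τ)) o) ⟨
        1# + - (1# - τ) * Σo
          ≈⟨ +-congˡ (-‿distribˡ-* (1# - τ) Σo) ⟨
        1# + - ((1# - τ) * Σo) ∎

    -- For w(0) = k, row 0 gives a factor independent of the remaining permutation. The sum over
    -- that permutation is the same statement for the variables other than yₖ, with a value
    -- independent of k, and `sum-others` adds up the row factors.
    symmetrization : ∀ n (y : Fin n → Carrier) (d : Fin n → Fin n → Carrier) →
      (∀ i j → i ≢ j → (y i - y j) * d i j ≈ 1#) →
      (e : Fin n → Carrier) → (∀ i → y i * e i ≈ 1#) →
      sumS n (λ w → ∏.upper n λ i j →
        (y (w ⟨$⟩ʳ i) - τ * y (w ⟨$⟩ʳ j)) * d (w ⟨$⟩ʳ i) (w ⟨$⟩ʳ j)) ≈ qFactorial τ n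
    symmetrization zero    y d d-inv e e-inv = +-identityʳ 1#
    symmetrization (suc n) y d d-inv e e-inv = begin
      sumS (suc n) (λ w → ∏.upper (suc n) λ i j → φ (w ⟨$⟩ʳ i) (w ⟨$⟩ʳ j))
        ≈⟨ sumS-suc n _ ⟩
      sum {suc n} (λ k → sumS n (λ π → ∏.upper (suc n) λ i j → φ (insert zero k π ⟨$⟩ʳ i) (insert zero k π ⟨$⟩ʳ j)))
        ≈⟨ sum-cong-≋ {suc n} (λ k → trans (sumList-cong (λ π → ∏.upper-insert n φ k π) (S n))
                                   (sumList-*ˡ (row k) (λ π → rest k π) (S n))) ⟩
      sum {suc n} (λ k → row k * sumS n (rest k))
        ≈⟨ sum-cong-≋ {suc n} (λ k → *-cong (sym (others≈punchIn n φ k)) (symmetrization n (y ∘ punchIn k)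
             (λ i j → d (punchIn k i) (punchIn k j))
             (λ i j i≢j → d-inv _ _ (i≢j ∘ Finₚ.punchIn-injective k i j)) (e ∘ punchIn k) (e-inv ∘ punchIn k))) ⟩
      sum {suc n} (λ k → others (suc n) φ k * qFactorial τ n)
        ≈⟨ *-distribʳ-sum {suc n} (qFactorial τ n) (others (suc n) φ) ⟨
      sum {suc n} (others (suc n) φ) * qFactorial τ n
        ≈⟨ *-congʳ (sum-others (suc n) y d d-inv e e-inv) ⟩
      qFactorial τ (suc n) ∎
      where
      φ : Fin (suc n) → Fin (suc n) → Carrier
      φ i j = (y i - τ * y j) * d i j
      row : Fin (suc n) → Carrier
      row k = product {n} (λ j → φ k (punchIn k j))
      rest : Fin (suc n) → Permutation′ n → Carrier
      rest k π = ∏.upper n λ i j → φ (punchIn k (π ⟨$⟩ʳ i)) (punchIn k (π ⟨$⟩ʳ j))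

  -- (s⁻¹ - s x⁻¹y)/(1 - x⁻¹y) = s⁻¹(x - s²y)/(x - y)
  clear-inverse : ∀ {s s⁻¹ τ x x⁻¹ y v d} → s⁻¹ * τ ≈ s → x * x⁻¹ ≈ 1# →
    (1# - x⁻¹ * y) * v ≈ 1# → (x - y) * d ≈ 1# →
    (s⁻¹ - s * (x⁻¹ * y)) * v ≈ s⁻¹ * ((x - τ * y) * d)
  clear-inverse {s} {s⁻¹} {τ} {x} {x⁻¹} {y} {v} {d} s⁻¹τ≈s x-inv v-inv d-inv = sym (begin
    s⁻¹ * ((x - τ * y) * d)
      ≈⟨ *-congˡ (*-congˡ d≈) ⟩
    s⁻¹ * ((x - τ * y) * (x⁻¹ * v))
      ≈⟨ solve 5 (λ s x m u v → s :* ((x :+ m) :* (u :* v)) := (s :* (x :* u) :+ s :* m :* u) :* v) refl s⁻¹ x (- (τ * y)) x⁻¹ v ⟩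
    (s⁻¹ * (x * x⁻¹) + s⁻¹ * - (τ * y) * x⁻¹) * v
      ≈⟨ *-congʳ (+-cong (trans (*-congˡ x-inv) (*-identityʳ s⁻¹)) lower) ⟩
    (s⁻¹ - s * (x⁻¹ * y)) * v ∎)
    where
    lower : s⁻¹ * - (τ * y) * x⁻¹ ≈ - (s * (x⁻¹ * y))
    lower = begin
      s⁻¹ * - (τ * y) * x⁻¹    ≈⟨ *-congʳ (-‿distribʳ-* s⁻¹ (τ * y)) ⟨
      - (s⁻¹ * (τ * y)) * x⁻¹  ≈⟨ -‿distribˡ-* _ x⁻¹ ⟨
      - (s⁻¹ * (τ * y) * x⁻¹)  ≈⟨ -‿cong (solve 4 (λ s τ y u → s :* (τ :* y) :* u := (s :* τ) :* (u :* y)) refl s⁻¹ τ y x⁻¹) ⟩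
      - (s⁻¹ * τ * (x⁻¹ * y))  ≈⟨ -‿cong (*-congʳ s⁻¹τ≈s) ⟩
      - (s * (x⁻¹ * y))        ∎
    d≈ : d ≈ x⁻¹ * v
    d≈ = inverse-unique d-inv (begin
      (x - y) * (x⁻¹ * v)             ≈⟨ solve 4 (λ x m u v → (x :+ m) :* (u :* v) := (x :* u :+ u :* m) :* v) refl x (- y) x⁻¹ v ⟩
      (x * x⁻¹ + x⁻¹ * - y) * v       ≈⟨ *-congʳ (+-cong x-inv (sym (-‿distribʳ-* x⁻¹ y))) ⟩
      (1# - x⁻¹ * y) * v              ≈⟨ v-inv ⟩
      1#                              ∎)

  ^-inverse-cancel : ∀ {s s⁻¹} → s * s⁻¹ ≈ 1# → ∀ a b → s⁻¹ ^ a * s ^ (a ℕ.+ b) ≈ s ^ b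
  ^-inverse-cancel {s} {s⁻¹} s-inv zero    b = *-identityˡ _
  ^-inverse-cancel {s} {s⁻¹} s-inv (suc a) b = begin
    s⁻¹ * s⁻¹ ^ a * (s * s ^ (a ℕ.+ b))    ≈⟨ solve 4 (λ u p s q → u :* p :* (s :* q) := (s :* u) :* (p :* q)) refl s⁻¹ (s⁻¹ ^ a) s (s ^ (a ℕ.+ b)) ⟩
    (s * s⁻¹) * (s⁻¹ ^ a * s ^ (a ℕ.+ b))  ≈⟨ *-cong s-inv (^-inverse-cancel s-inv a b) ⟩
    1# * s ^ b                             ≈⟨ *-identityˡ _ ⟩
    s ^ b                                  ∎

-- Stated for relations because evaluation is only a partial function.
module MultiplicativeRelation {a b ℓ₁ ℓ₂ ℓ : Level} (A : CommutativeRing a ℓ₁) (B : CommutativeRing b ℓ₂)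
  (_~_ : CommutativeRing.Carrier A → CommutativeRing.Carrier B → Set ℓ)
  (1~1 : CommutativeRing.1# A ~ CommutativeRing.1# B)
  (*~* : ∀ {x x′ y y′} → x ~ y → x′ ~ y′ → CommutativeRing._*_ A x x′ ~ CommutativeRing._*_ B y y′)
  where
  private
    module A = RingNotation A
    module B = RingNotation B

  product~ : ∀ {n} (f : Fin n → CommutativeRing.Carrier A) (g : Fin n → CommutativeRing.Carrier B) →
             (∀ i → f i ~ g i) → A.product f ~ B.product g
  product~ {zero}  f g f~g = 1~1
  product~ {suc n} f g f~g = *~* (f~g zero) (product~ (f ∘ suc) (g ∘ suc) (f~g ∘ suc))

  ∏<~ : ∀ n f g → (∀ i j i<j → f i j i<j ~ g i j i<j) → A.∏< n f ~ B.∏< n g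
  ∏<~ n f g f~g = product~ _ _ λ i → product~ _ _ λ j → factor i j (i <? j)
    where
    -- Abstracting the decision makes both products split on the same case.
    factor : ∀ i j (d : Dec (i <ᶠ j)) → A.factorIf (f i j) d ~ B.factorIf (g i j) d
    factor i j (yes i<j) = f~g i j i<j
    factor i j (no  _)   = 1~1

-- Rational functions

module FractionLemmas {c ℓ : Level} (A : CommutativeRing c ℓ) where
  open CommutativeRing A
  open Fractions A

  *-inv : ∀ x (reg : RegularF x) → x *F inv x reg ≈F ι 1#
  *-inv x reg = cross (trans (*-identityʳ _) (trans (*-comm _ _) (sym (*-identityˡ _))))

  inv-cong : ∀ {x y} (rx : RegularF x) (ry : RegularF y) → x ≈F y → inv x rx ≈F inv y ry
  inv-cong rx ry (cross e) = cross (trans (*-comm _ _) (trans (sym e) (*-comm _ _)))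

  ι-cong : ∀ {a b} → a ≈ b → ι a ≈F ι b
  ι-cong a≈b = cross (*-congʳ a≈b)

  ι-+ : ∀ a b → ι (a + b) ≈F ι a +F ι b
  ι-+ a b = cross (*-cong (+-cong (sym (*-identityʳ a)) (sym (*-identityʳ b))) (*-identityʳ 1#))

  ι-* : ∀ a b → ι (a * b) ≈F ι a *F ι b
  ι-* a b = cross (*-congˡ (*-identityʳ 1#))

module RationalFunctionLemmas {c ℓ : Level} (R : CommutativeRing c ℓ) (m : ℕ) where
  private
    module R = CommutativeRing R
    module RL = RingLemmas R
  open RationalFunction R m
  open FractionLemmas ring
  open RingNotation fractionRing using (_^_)
  private module FL = RingLemmas fractionRing

  const-+ : ∀ a b → const (a R.+ b) F.≈ const a F.+ const b
  const-+ a b = F.trans (ι-cong (con-+ a b)) (ι-+ (con a) (con b))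

  const-* : ∀ a b → const (a R.* b) F.≈ const a F.* const b
  const-* a b = F.trans (ι-cong (con-* a b)) (ι-* (con a) (con b))

  const-cong : ∀ {a b} → a R.≈ b → const a F.≈ const b
  const-cong a≈b = ι-cong (con-cong a≈b)

  const-- : ∀ a b → const (a R.- b) F.≈ const a F.- const b
  const-- a b = F.trans (const-+ a (R.- b))
    (F.+-congˡ {const a} (F.trans (ι-cong (IsRingHomomorphism.-‿homo con-isRingHomomorphism b)) (cross P.refl)))

  const-^ : ∀ a k → const (RingNotation._^_ R a k) F.≈ const a ^ k
  const-^ a zero    = F.refl
  const-^ a (suc k) = F.trans (const-* a _) (F.*-congˡ {const a} (const-^ a k))

  const-geometric : ∀ τ n → const (RL.geometric τ n) F.≈ FL.geometric (const τ) n
  const-geometric τ n = const-sum {n} (λ i → RingNotation._^_ R τ (toℕ i)) _ (λ i → const-^ τ (toℕ i))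
    where
    open SemiringSum F.semiring using () renaming (sum to sumF)
    open SemiringSum R.semiring using () renaming (sum to sumR)
    const-sum : ∀ {n} (f : Fin n → R.Carrier) (g : Fin n → Frac) →
                (∀ i → const (f i) F.≈ g i) → const (sumR f) F.≈ sumF g
    const-sum {zero}  f g eq = F.refl
    const-sum {suc n} f g eq = F.trans (const-+ (f zero) _) (F.+-cong (eq zero) (const-sum (f ∘ suc) (g ∘ suc) (eq ∘ suc)))

  const-qFactorial : ∀ τ n → const (RL.qFactorial τ n) F.≈ FL.qFactorial (const τ) n
  const-qFactorial τ zero    = F.refl
  const-qFactorial τ (suc n) = F.trans (const-* _ _) (F.*-cong (const-geometric τ (suc n)) (const-qFactorial τ n))

  -- The action of a permutation

  module _ (w : Permutation′ m) where

    ·-cong : ∀ {f g} → f F.≈ g → w · f F.≈ w · g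
    ·-cong (cross e) = cross (subst-cong _ e)

    ·-* : ∀ f g → w · (f F.* g) F.≈ (w · f) F.* (w · g)
    ·-* f g = cross P.refl

    ·-1 : w · F.1# F.≈ F.1#
    ·-1 = cross P.refl

    -- Provides inverses of the permuted denominators without any comparison of regularity proofs.
    ·-inverse : ∀ {f g} → f F.* g F.≈ F.1# → (w · f) F.* (w · g) F.≈ F.1#
    ·-inverse {f} {g} fg≈1 = F.trans (F.sym (·-* f g)) (F.trans (·-cong fg≈1) ·-1)

    open MultiplicativeRelation fractionRing fractionRing (λ f g → w · f F.≈ g) ·-1
      (λ {f} {f′} e e′ → F.trans (·-* f f′) (F.*-cong e e′)) public
      using () renaming (∏<~ to ·-∏<)

  private
    X-X-regular : ∀ i j → i ≢ j → RegularF (X i F.- X j)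
    X-X-regular i j i≢j = frac-regular (RingNotation.regular-cong ring
      (P.+-cong (P.sym (P.*-identityʳ _)) (P.sym (P.*-identityʳ _))) (var-var-regular i j i≢j))

  -- 1/(Xᵢ - Xⱼ), with the junk value 0 on the diagonal
  1/[X-X] : Fin m → Fin m → Frac
  1/[X-X] i j with i ≟ j
  ... | yes _   = F.0#
  ... | no  i≢j = inv (X i F.- X j) (X-X-regular i j i≢j)

  1/[X-X]-inverse : ∀ i j → i ≢ j → (X i F.- X j) F.* 1/[X-X] i j F.≈ F.1#
  1/[X-X]-inverse i j i≢j with i ≟ j
  ... | yes i≡j = contradiction i≡j i≢j
  ... | no  i≢j = *-inv (X i F.- X j) (X-X-regular i j i≢j)

  -- Arithmetic of the partial evaluation

  module _ (y : Fin m → R.Carrier) where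
    private
      module Rn = RingNotation R
      module S = NatSolver R.commutativeSemiring
      open RingProperties R.ring using (-‿distribˡ-*)
      ev : Poly → R.Carrier
      ev = evalAt y

    EvaluatesTo-cong : ∀ {f g v u} → f F.≈ g → v R.≈ u → EvaluatesTo y f v → EvaluatesTo y g u
    EvaluatesTo-cong f≈g v≈u (h , f≈h , rh , eh) =
      h , F.trans (F.sym f≈g) f≈h , rh , R.trans eh (R.*-congʳ v≈u)

    EvaluatesTo-ι : ∀ p → EvaluatesTo y (ι p) (ev p)
    EvaluatesTo-ι p = ι p , F.refl , Rn.regular-1 , R.sym (R.*-identityʳ _)

    EvaluatesTo-* : ∀ {f g v u} → EvaluatesTo y f v → EvaluatesTo y g u → EvaluatesTo y (f F.* g) (v R.* u)
    EvaluatesTo-* {v = v} {u} (h , f≈h , rh , eh) (k , g≈k , rk , ek) =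
      h F.* k , F.*-cong f≈h g≈k , Rn.regular-* rh rk ,
      R.trans (R.*-cong eh ek)
        (S.solve 4 (λ v d u e → (v S.:* d) S.:* (u S.:* e) S.:= (v S.:* u) S.:* (d S.:* e))
          R.refl v (ev (den h)) u (ev (den k)))

    EvaluatesTo-- : ∀ {f g v u} → EvaluatesTo y f v → EvaluatesTo y g u → EvaluatesTo y (f F.- g) (v R.- u)
    EvaluatesTo-- {v = v} {u} (h , f≈h , rh , eh) (k , g≈k , rk , ek) =
      h F.- k , F.+-cong f≈h (F.-‿cong g≈k) , Rn.regular-* rh rk ,
      R.trans (R.+-cong (R.*-congʳ eh) (R.*-congʳ (R.trans (R.-‿cong ek) (-‿distribˡ-* u (ev (den k))))))
        (S.solve 4 (λ v d u e → (v S.:* d) S.:* e S.:+ (u S.:* e) S.:* d S.:= (v S.:+ u) S.:* (d S.:* e))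
          R.refl v (ev (den h)) (R.- u) (ev (den k)))

    -- The representing fraction `h` is turned upside down. Its numerator evaluates to v times a
    -- regular element, which is regular because v is a unit.
    EvaluatesTo-inv : ∀ {f v u} (reg : RegularF f) → v R.* u R.≈ R.1# →
                      EvaluatesTo y f v → EvaluatesTo y (inv f reg) u
    EvaluatesTo-inv {f} {v} {u} reg vu≈1 (h , f≈h , rh , eh) =
      inv h reg-h , inv-cong reg reg-h f≈h ,
      Rn.regular-cong (R.sym eh) (Rn.regular-* (RL.unit-regular vu≈1) rh) ,
      R.sym (begin
        u R.* ev (num h)             ≈⟨ R.*-congˡ eh ⟩
        u R.* (v R.* ev (den h))     ≈⟨ S.solve 3 (λ u v d → u S.:* (v S.:* d) S.:= (v S.:* u) S.:* d) R.refl u v (ev (den h)) ⟩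
        (v R.* u) R.* ev (den h)     ≈⟨ R.*-congʳ vu≈1 ⟩
        R.1# R.* ev (den h)          ≈⟨ R.*-identityˡ _ ⟩
        ev (den h)                   ∎)
      where
      open SetoidReasoning R.setoid
      reg-h : RegularF h
      reg-h = RingNotation.regular-cong fractionRing f≈h reg

    open MultiplicativeRelation fractionRing R (EvaluatesTo y) (EvaluatesTo-ι (con R.1#)) EvaluatesTo-* public
      using () renaming (∏<~ to EvaluatesTo-∏<)

-- The c-functions

open import Data.Integer.Base using (-_)

-- A difference of two naturals is the form that `t½^-⊖` splits into a positive and a negative
-- power.
ev₀-exponent : ∀ n i → (+ n ℤ.- + 1) ℤ.- + 2 ℤ.* + i ≡ n ⊖ suc (2 ℕ.* i)
ev₀-exponent n i = begin
  (+ n ℤ.- + 1) ℤ.- + 2 ℤ.* + i            ≡⟨ ≡.cong (λ x → (+ n ℤ.- + 1) ℤ.- x) (ℤₚ.pos-* 2 i) ⟨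
  (+ n ℤ.- + 1) ℤ.- + (2 ℕ.* i)            ≡⟨ ℤₚ.+-assoc (+ n) (- + 1) (- + (2 ℕ.* i)) ⟩
  + n ℤ.+ (- + 1 ℤ.- + (2 ℕ.* i))          ≡⟨ ≡.cong (λ x → + n ℤ.+ x) (ℤₚ.neg-distrib-+ (+ 1) (+ (2 ℕ.* i))) ⟨
  + n ℤ.- + suc (2 ℕ.* i)                  ≡⟨ ℤₚ.m-n≡m⊖n n (suc (2 ℕ.* i)) ⟩
  n ⊖ suc (2 ℕ.* i)                        ∎
  where open ≡.≡-Reasoning

module _ {c ℓ₁ ℓ₂ : Level} (K : HeytingField c ℓ₁ ℓ₂) where
  open CFunctions K
  open 𝕃 using (_*_; _-_; _≈_; 1#)
  open RingNotation 𝕃ring using (_^_; ∏<)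
  open RingLemmas 𝕃ring
  open Exp 𝕃.commutativeSemiring using (^-congʳ; ^-assocʳ)
  open SetoidReasoning 𝕃.setoid
  open NatSolver 𝕃.commutativeSemiring using (solve; _:=_; _:*_)
  open FractionLemmas T.ring using (*-inv)

  t½-inverse : t½ * t½⁻¹ ≈ 1#
  t½-inverse = *-inv (T.X zero) (T.X-regular zero)

  t½⁻¹*t : t½⁻¹ * t ≈ t½
  t½⁻¹*t = begin
    t½⁻¹ * (t½ * (t½ * 1#))   ≈⟨ solve 3 (λ s u o → u :* (s :* (s :* o)) := (s :* u) :* (s :* o)) 𝕃.refl t½ t½⁻¹ 1# ⟩
    (t½ * t½⁻¹) * (t½ * 1#)   ≈⟨ 𝕃.*-cong t½-inverse (𝕃.*-identityʳ t½) ⟩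
    1# * t½                   ≈⟨ 𝕃.*-identityˡ t½ ⟩
    t½                        ∎

  -- The three formulas for the Poincaré polynomial

  1/[1-t^1+_] : ℕ → 𝕃
  1/[1-t^1+ k ] = T.inv (1# - t ^ suc k) (1-t^-regular (suc k) (s≤s z≤n))

  1-t^-inverse : ∀ k → (1# - t ^ suc k) * 1/[1-t^1+ k ] ≈ 1#
  1-t^-inverse k = *-inv (1# - t ^ suc k) (1-t^-regular (suc k) (s≤s z≤n))

  1-t^-inverse-pred : ∀ d → 0 ℕ.< d → (1# - t ^ d) * 1/[1-t^1+ ℕ.pred d ] ≈ 1#
  1-t^-inverse-pred (suc k) _ = 1-t^-inverse k

  root : ∀ {n} → Fin n → Fin n → 𝕃
  root = rootFactor t 1/[1-t^1+_] 1-t^-inverse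

  W₀≈qFactorial : ∀ n → W₀ n ≈ qFactorial t n
  W₀≈qFactorial = sumS-^length t

  rootProduct≈qFactorial : ∀ n → rootProduct n ≈ qFactorial t n
  rootProduct≈qFactorial n = 𝕃.trans
    (∏<≈upper n _ root λ i j i<j → 𝕃.*-cong
      (𝕃.+-congˡ (𝕃.-‿cong (^-congʳ t (ℕₚ.+-comm (toℕ j ℕ.∸ toℕ i) 1))))
      -- The quotient in `rootProduct` carries its own regularity proof; both elements invert 1 -
      -- t^(j-i), hence they agree.
      (inverse-unique (*-inv _ _) (1-t^-inverse-pred (toℕ j ℕ.∸ toℕ i) (ℕₚ.m<n⇒0<n∸m i<j))))
    (upper-rootFactor t 1/[1-t^1+_] 1-t^-inverse n)

  []!≈qFactorial : ∀ n → [ n ]! ≈ qFactorial t n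
  []!≈qFactorial n = 𝕃.trans
    (∏.sum-cong-≋ {n} λ d → 𝕃.*-congˡ (inverse-unique (*-inv (1# - t) 1-t-regular)
      (𝕃.trans (𝕃.*-congʳ (𝕃.+-congˡ (𝕃.-‿cong (𝕃.sym (𝕃.*-identityʳ t))))) (1-t^-inverse 0))))
    (product-qIntegers t 1/[1-t^1+_] 1-t^-inverse n)

  -- Half-integer powers and the evaluation point

  t½^-neg : ∀ k → t½^ (- + k) ≈ t½⁻¹ ^ k
  t½^-neg zero    = 𝕃.refl
  t½^-neg (suc k) = 𝕃.refl

  t½^-⊖ : ∀ m k → t½^ (m ⊖ k) ≈ t½ ^ m * t½⁻¹ ^ k
  t½^-⊖ m       zero    = 𝕃.sym (𝕃.*-identityʳ _)
  t½^-⊖ zero    (suc k) = 𝕃.sym (𝕃.*-identityˡ _)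
  t½^-⊖ (suc m) (suc k) = begin
    t½^ (suc m ⊖ suc k)                        ≡⟨ ≡.cong t½^ (ℤₚ.[1+m]⊖[1+n]≡m⊖n m k) ⟩
    t½^ (m ⊖ k)                                ≈⟨ t½^-⊖ m k ⟩
    t½ ^ m * t½⁻¹ ^ k                          ≈⟨ 𝕃.*-identityˡ _ ⟨
    1# * (t½ ^ m * t½⁻¹ ^ k)                   ≈⟨ 𝕃.*-congʳ t½-inverse ⟨
    t½ * t½⁻¹ * (t½ ^ m * t½⁻¹ ^ k)
      ≈⟨ solve 4 (λ s u p q → s :* u :* (p :* q) := (s :* p) :* (u :* q)) 𝕃.refl t½ t½⁻¹ (t½ ^ m) (t½⁻¹ ^ k) ⟩
    t½ ^ suc m * t½⁻¹ ^ suc k                  ∎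

  t½⁻¹^*t½^ : ∀ k → t½⁻¹ ^ k * t½ ^ k ≈ 1#
  t½⁻¹^*t½^ k = 𝕃.trans (𝕃.*-congˡ (^-congʳ t½ (≡.sym (ℕₚ.+-identityʳ k)))) (^-inverse-cancel t½-inverse k 0)

  module _ (n : ℕ) where

    y y⁻¹ : Fin n → 𝕃
    y       = ev₀-point n
    y⁻¹ i   = t½⁻¹ ^ n * t½ ^ suc (2 ℕ.* toℕ i)

    y≈ : ∀ i → y i ≈ t½ ^ n * t½⁻¹ ^ suc (2 ℕ.* toℕ i)
    y≈ i = 𝕃.trans (𝕃.reflexive (≡.cong t½^ (ev₀-exponent n (toℕ i)))) (t½^-⊖ n (suc (2 ℕ.* toℕ i)))

    -- The powers depending on n cancel, leaving t^(1/2) to the power (2j+1) - (2i+1). The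
    -- hypothesis makes the truncated subtraction exact, and i = j shows that `y⁻¹` inverts `y`.
    y*y⁻¹ : ∀ i j → toℕ i ℕ.≤ toℕ j → y i * y⁻¹ j ≈ t ^ (toℕ j ℕ.∸ toℕ i)
    y*y⁻¹ i j i≤j = begin
      y i * y⁻¹ j
        ≈⟨ 𝕃.*-congʳ (y≈ i) ⟩
      t½ ^ n * t½⁻¹ ^ a * (t½⁻¹ ^ n * t½ ^ b)
        ≈⟨ solve 4 (λ p q r s → p :* q :* (r :* s) := (r :* p) :* (q :* s)) 𝕃.refl (t½ ^ n) (t½⁻¹ ^ a) (t½⁻¹ ^ n) (t½ ^ b) ⟩
      (t½⁻¹ ^ n * t½ ^ n) * (t½⁻¹ ^ a * t½ ^ b)
        ≈⟨ 𝕃.*-cong (t½⁻¹^*t½^ n) (𝕃.*-congˡ (^-congʳ t½ b≡a+2d)) ⟩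
      1# * (t½⁻¹ ^ a * t½ ^ (a ℕ.+ 2 ℕ.* d))
        ≈⟨ 𝕃.*-identityˡ _ ⟩
      t½⁻¹ ^ a * t½ ^ (a ℕ.+ 2 ℕ.* d)
        ≈⟨ ^-inverse-cancel t½-inverse a (2 ℕ.* d) ⟩
      t½ ^ (2 ℕ.* d)
        ≈⟨ ^-assocʳ t½ 2 d ⟨
      t ^ d ∎
      where
      a b d : ℕ
      a = suc (2 ℕ.* toℕ i)
      b = suc (2 ℕ.* toℕ j)
      d = toℕ j ℕ.∸ toℕ i
      b≡a+2d : b ≡ a ℕ.+ 2 ℕ.* d
      b≡a+2d = ≡.cong suc (≡.trans (≡.cong (2 ℕ.*_) (≡.sym (ℕₚ.m+[n∸m]≡n i≤j))) (ℕₚ.*-distribˡ-+ 2 (toℕ i) d))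

    y-inverse : ∀ i → y i * y⁻¹ i ≈ 1#
    y-inverse i = 𝕃.trans (y*y⁻¹ i i ℕₚ.≤-refl) (^-congʳ t (ℕₚ.n∸n≡0 (toℕ i)))

    open 𝕃⟨X⟩ n
    open RationalFunctionLemmas 𝕃ring n
    private
      module FR = RingNotation fractionRing
      module FL = RingLemmas fractionRing

    -- The evaluation of `cY`

    upper-t½⁻¹* : ∀ (f : Fin n → Fin n → 𝕃) → ∏.upper n (λ i j → t½⁻¹ * f i j) ≈ t½⁻¹ ^ triangle n * ∏.upper n f
    upper-t½⁻¹* f = 𝕃.trans (∏.upper-∙ n (λ _ _ → t½⁻¹) f) (𝕃.*-congʳ (∏.upper-const n t½⁻¹))

    -- With d = j - i, each factor evaluates to t^(-1/2) (1 - t^(d+1))/(1 - t^d). The powers of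
    -- t^(-1/2) are collected over all pairs, and the quotients form the root product.
    cY-value : ev₀ n (cY n) (t½⁻¹ ^ triangle n * qFactorial t n)
    cY-value = EvaluatesTo-cong y F.refl product-value
      (EvaluatesTo-∏< y n _ (λ i j _ → t½⁻¹ * root i j) factor-value)
      where
      product-value : ∏< n (λ i j _ → t½⁻¹ * root i j) ≈ t½⁻¹ ^ triangle n * qFactorial t n
      product-value = begin
        ∏< n (λ i j _ → t½⁻¹ * root i j)         ≈⟨ ∏<≈upper n _ (λ i j → t½⁻¹ * root i j) (λ _ _ _ → 𝕃.refl) ⟩
        ∏.upper n (λ i j → t½⁻¹ * root i j)      ≈⟨ upper-t½⁻¹* root ⟩
        t½⁻¹ ^ triangle n * ∏.upper n root       ≈⟨ 𝕃.*-congˡ (upper-rootFactor t 1/[1-t^1+_] 1-t^-inverse n) ⟩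
        t½⁻¹ ^ triangle n * qFactorial t n       ∎

      factor-value : ∀ i j (i<j : i <ᶠ j) →
        ev₀ n (cFactor n (X i F.* X⁻¹ j) (1-XᵢXⱼ⁻¹-regular i j (Finₚ.<⇒≢ i<j))) (t½⁻¹ * root i j)
      factor-value i j i<j = EvaluatesTo-cong y F.refl value
        (EvaluatesTo-* y
          (EvaluatesTo-- y (EvaluatesTo-ι y (con t½⁻¹)) (EvaluatesTo-* y (EvaluatesTo-ι y (con t½)) z-value))
          -- Since i < j, the exponent d is positive and 1 - t^d is invertible, so the denominator
          -- may be evaluated.
          (EvaluatesTo-inv y (1-XᵢXⱼ⁻¹-regular i j (Finₚ.<⇒≢ i<j))
            (1-t^-inverse-pred d (ℕₚ.m<n⇒0<n∸m i<j)) (EvaluatesTo-- y (EvaluatesTo-ι y (con 1#)) z-value)))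
        where
        d : ℕ
        d = toℕ j ℕ.∸ toℕ i
        z-value : ev₀ n (X i F.* X⁻¹ j) (t ^ d)
        z-value = EvaluatesTo-cong y F.refl (y*y⁻¹ i j (ℕₚ.<⇒≤ i<j))
          (EvaluatesTo-* y (EvaluatesTo-ι y (var i))
            (EvaluatesTo-inv y (X-regular j) (y-inverse j) (EvaluatesTo-ι y (var j))))
        value : (t½⁻¹ - t½ * t ^ d) * 1/[1-t^1+ ℕ.pred d ] ≈ t½⁻¹ * root i j
        value = begin
          (t½⁻¹ - t½ * t ^ d) * 1/[1-t^1+ ℕ.pred d ]
            ≈⟨ 𝕃.*-congʳ (𝕃.+-cong (𝕃.sym (𝕃.*-identityʳ t½⁻¹))
                 (𝕃.-‿cong (𝕃.trans (𝕃.*-congʳ (𝕃.sym t½⁻¹*t)) (𝕃.*-assoc t½⁻¹ t (t ^ d))))) ⟩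
          (t½⁻¹ * 1# - t½⁻¹ * t ^ suc d) * 1/[1-t^1+ ℕ.pred d ]
            ≈⟨ 𝕃.*-congʳ (x[y-z]≈xy-xz t½⁻¹ 1# (t ^ suc d)) ⟨
          t½⁻¹ * (1# - t ^ suc d) * 1/[1-t^1+ ℕ.pred d ]
            ≈⟨ 𝕃.*-assoc _ _ _ ⟩
          t½⁻¹ * root i j ∎
          where open RingProperties 𝕃.ring using (x[y-z]≈xy-xz)

    -- The sum over the symmetric group

    φ : Fin n → Fin n → Frac
    φ i j = (X i F.- const t F.* X j) F.* 1/[X-X] i j

    ·-cFactor : ∀ (w : Permutation′ n) i j (i<j : i <ᶠ j) →
      w · cFactor n (X⁻¹ i F.* X j) (1-Xᵢ⁻¹Xⱼ-regular i j (Finₚ.<⇒≢ i<j)) F.≈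
      const t½⁻¹ F.* φ (w ⟨$⟩ʳ i) (w ⟨$⟩ʳ j)
    -- w · commutes with the operations on fractions by computation, hence cross P.refl.
    ·-cFactor w i j i<j = F.trans (cross P.refl) (FL.clear-inverse {s = const t½} {x⁻¹ = w · X⁻¹ i}
      {v = w · inv (F.1# F.- X⁻¹ i F.* X j) reg}
      (F.trans (F.sym (const-* t½⁻¹ t)) (const-cong t½⁻¹*t))
      (F.trans (cross P.refl) (·-inverse w {X i} {X⁻¹ i} (FractionLemmas.*-inv ring (X i) (X-regular i))))
      (F.trans (cross P.refl) (·-inverse w {F.1# F.- X⁻¹ i F.* X j} {inv _ reg}
        (FractionLemmas.*-inv ring (F.1# F.- X⁻¹ i F.* X j) reg)))
      (1/[X-X]-inverse _ _ (⟨$⟩ʳ-≢ w (Finₚ.<⇒≢ i<j))))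
      where
      reg : RegularF (F.1# F.- X⁻¹ i F.* X j)
      reg = 1-Xᵢ⁻¹Xⱼ-regular i j (Finₚ.<⇒≢ i<j)

    ·-cX⁻¹ : ∀ w → w · cX⁻¹ n F.≈
             const t½⁻¹ FR.^ triangle n F.* FL.∏.upper n (λ i j → φ (w ⟨$⟩ʳ i) (w ⟨$⟩ʳ j))
    ·-cX⁻¹ w = F.trans
      (·-∏< w n _ (λ i j _ → const t½⁻¹ F.* φ (w ⟨$⟩ʳ i) (w ⟨$⟩ʳ j)) (·-cFactor w))
      (F.trans (FL.∏<≈upper n _ (λ i j → const t½⁻¹ F.* φ (w ⟨$⟩ʳ i) (w ⟨$⟩ʳ j)) (λ _ _ _ → F.refl))
        (F.trans (FL.∏.upper-∙ n (λ _ _ → const t½⁻¹) (λ i j → φ (w ⟨$⟩ʳ i) (w ⟨$⟩ʳ j)))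
                 (F.*-congʳ (FL.∏.upper-const n (const t½⁻¹)))))

    -- Supplies the unit hypothesis of `symmetrization` over the rational functions, with the
    -- constant t as τ.
    const-1-t-inverse : (F.1# F.- const t) F.* const 1/[1-t^1+ 0 ] F.≈ F.1#
    const-1-t-inverse = F.trans (F.*-congʳ (F.sym (const-- 1# t)))
      (F.trans (F.sym (const-* (1# - t) 1/[1-t^1+ 0 ]))
        (const-cong (𝕃.trans (𝕃.*-congʳ (𝕃.+-congˡ (𝕃.-‿cong (𝕃.sym (𝕃.*-identityʳ t))))) (1-t^-inverse 0))))

    -- Once t^(-1/2) is pulled out of every pair, this is `symmetrization` at the variables
    -- themselves; its value is a constant rational function.
    ∑w·cX⁻¹≈ : ∑w·cX⁻¹ n F.≈ const (t½⁻¹ ^ triangle n * qFactorial t n)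
    ∑w·cX⁻¹≈ = F.trans (FL.sumList-cong ·-cX⁻¹ (S n))
      (F.trans (FL.sumList-*ˡ (const t½⁻¹ FR.^ triangle n) (λ w → FL.∏.upper n (λ i j → φ (w ⟨$⟩ʳ i) (w ⟨$⟩ʳ j))) (S n))
      (F.trans (F.*-cong (F.sym (const-^ t½⁻¹ (triangle n)))
                 (F.trans (FL.symmetrization (const t) (const 1/[1-t^1+ 0 ]) const-1-t-inverse n
                            X 1/[X-X] 1/[X-X]-inverse X⁻¹
                            (λ i → FractionLemmas.*-inv ring (X i) (X-regular i)))
                   (F.sym (const-qFactorial t n))))
        (F.sym (const-* (t½⁻¹ ^ triangle n) (qFactorial t n)))))

-- Comparison of all expressions through the factorial in t

proposition4p5 : ∀ {c ℓ₁ ℓ₂} (K : HeytingField c ℓ₁ ℓ₂) →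
    let open CFunctions K in
    (n : ℕ) → n ≥ 1 →
    (w₀ : Permutation′ n) → IsLongest w₀ →
    let A = t½^ (- + length w₀) 𝕃.* W₀ n in
    (ev₀ n (cY n) A × 𝕃⟨X⟩._≈F_ n (𝕃⟨X⟩.const n A) (∑w·cX⁻¹ n)) ×
    (W₀ n 𝕃.≈ rootProduct n × rootProduct n 𝕃.≈ [ n ]!)
proposition4p5 K n _ w₀ longest =
  ( RF.EvaluatesTo-cong (ev₀-point n) F.refl (𝕃.sym A≈) (cY-value K n)
  , F.trans (RF.const-cong A≈) (F.sym (∑w·cX⁻¹≈ K n))) ,
  ( 𝕃.trans (W₀≈qFactorial K n) (𝕃.sym (rootProduct≈qFactorial K n))
  , 𝕃.trans (rootProduct≈qFactorial K n) (𝕃.sym ([]!≈qFactorial K n)))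
  where
  open CFunctions K
  open RingLemmas 𝕃ring using (qFactorial)
  open RingNotation 𝕃ring using (_^_)
  module F = CommutativeRing (𝕃⟨X⟩.fractionRing n)
  module RF = RationalFunctionLemmas 𝕃ring n
  A≈ : t½^ (- + length w₀) 𝕃.* W₀ n 𝕃.≈ t½⁻¹ ^ triangle n 𝕃.* qFactorial t n
  A≈ = 𝕃.*-cong
    -- Maximality of `w₀` enters here: it makes the exponent the number of pairs i < j, hence the
    -- number of factors t^(-1/2) pulled out of each c-function.
    (𝕃.trans (𝕃.reflexive (≡.cong (λ k → t½^ (- + k)) (length-longest w₀ longest))) (t½^-neg K (triangle n)))
    (W₀≈qFactorial K n)
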